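{- Let $G$ be a finite simple graph that is $(P_2+P_4,\,K_4-e)$-free and satisfies $\omega(G)\geq 3$. Then $\chi(G)\leq \max\{6,\omega(G)\}$. Moreover, this bound is tight for every value of $\omega(G)\notin\{4,5\}$: for every integer $k\geq 3$ with $k\notin\{4,5\}$ there exists a $(P_2+P_4,\,K_4-e)$-free graph $G$ with $\omega(G)=k$ and $\chi(G)=\max\{6,k\}$.
   Context: All graphs are finite, simple, undirected. $P_t$ is the chordless path on $t$ vertices, $K_t$ the complete graph on $t$ vertices, and $K_4-e$ is the graph obtained from $K_4$ by deleting one edge. $G_1+G_2$ denotes the disjoint union of two vertex-disjoint graphs. A graph $G$ contains $H$ if $H$ is an induced subgraph of $G$; $G$ is $\mathcal F$-free if it contains no graph of $\mathcal F$. $\chi(G)$ is the chromatic number and $\omega(G)$ the clique number. -}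

module Defs where

open import Data.Nat using (ℕ; zero; suc; _≤_; _⊔_)
open import Data.Fin using (Fin; zero; suc)
open import Data.Bool using (Bool; true; false)
open import Data.Product using (Σ; _×_; ∃)
open import Relation.Binary.PropositionalEquality using (_≡_; _≢_)
open import Function.Definitions using (Injective)

record Graph : Set where
  field
    n     : ℕ
    adj   : Fin n → Fin n → Bool
    adj-sym : ∀ u v → adj u v ≡ adj v u
    adj-irrefl : ∀ v → adj v v ≡ false
open Graph public

Contains : Graph → Graph → Set
Contains G H =
  Σ (Fin (n H) → Fin (n G)) λ f →
    Injective _≡_ _≡_ f × (∀ u v → adj G (f u) (f v) ≡ adj H u v)

Free : Graph → Graph → Set
Free G H = Contains G H → Data.Empty.⊥
  where import Data.Empty

K4-e-adj : Fin 4 → Fin 4 → Bool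
K4-e-adj u v = go (Data.Fin.toℕ u) (Data.Fin.toℕ v)
  where
  import Data.Fin
  go : ℕ → ℕ → Bool
  go 0 1 = true
  go 0 2 = true
  go 0 3 = true
  go 1 0 = true
  go 1 2 = true
  go 1 3 = true
  go 2 0 = true
  go 2 1 = true
  go 3 0 = true
  go 3 1 = true
  go _ _ = false

K4-e : Graph
K4-e = record { n = 4 ; adj = K4-e-adj ; adj-sym = s ; adj-irrefl = i }
  where
  open import Relation.Binary.PropositionalEquality using (refl)
  s : ∀ u v → K4-e-adj u v ≡ K4-e-adj v u
  s zero zero = refl
  s zero (suc zero) = refl
  s zero (suc (suc zero)) = refl
  s zero (suc (suc (suc zero))) = refl
  s (suc zero) zero = refl
  s (suc zero) (suc zero) = refl
  s (suc zero) (suc (suc zero)) = refl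
  s (suc zero) (suc (suc (suc zero))) = refl
  s (suc (suc zero)) zero = refl
  s (suc (suc zero)) (suc zero) = refl
  s (suc (suc zero)) (suc (suc zero)) = refl
  s (suc (suc zero)) (suc (suc (suc zero))) = refl
  s (suc (suc (suc zero))) zero = refl
  s (suc (suc (suc zero))) (suc zero) = refl
  s (suc (suc (suc zero))) (suc (suc zero)) = refl
  s (suc (suc (suc zero))) (suc (suc (suc zero))) = refl
  i : ∀ v → K4-e-adj v v ≡ false
  i zero = refl
  i (suc zero) = refl
  i (suc (suc zero)) = refl
  i (suc (suc (suc zero))) = refl

P2+P4-adj : Fin 6 → Fin 6 → Bool
P2+P4-adj u v = go (Data.Fin.toℕ u) (Data.Fin.toℕ v)
  where
  import Data.Fin
  go : ℕ → ℕ → Bool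
  go 0 1 = true
  go 1 0 = true
  go 2 3 = true
  go 3 2 = true
  go 3 4 = true
  go 4 3 = true
  go 4 5 = true
  go 5 4 = true
  go _ _ = false

P2+P4 : Graph
P2+P4 = record { n = 6 ; adj = P2+P4-adj ; adj-sym = s ; adj-irrefl = i }
  where
  open import Data.Fin.Properties using (all?)
  open import Relation.Nullary.Decidable using (from-yes)
  open import Data.Bool.Properties using (_≟_)
  s : ∀ u v → P2+P4-adj u v ≡ P2+P4-adj v u
  s = from-yes (all? λ u → all? λ v → P2+P4-adj u v ≟ P2+P4-adj v u)
  i : ∀ v → P2+P4-adj v v ≡ false
  i = from-yes (all? λ v → P2+P4-adj v v ≟ false)

HasClique : Graph → ℕ → Set
HasClique G k =
  Σ (Fin k → Fin (n G)) λ f →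
    Injective _≡_ _≡_ f × (∀ u v → u ≢ v → adj G (f u) (f v) ≡ true)

CliqueNumber : Graph → ℕ → Set
CliqueNumber G k = HasClique G k × (HasClique G (suc k) → Data.Empty.⊥)
  where import Data.Empty

Colourable : Graph → ℕ → Set
Colourable G c =
  Σ (Fin (n G) → Fin c) λ col →
    ∀ u v → adj G u v ≡ true → col u ≢ col v

ChromaticNumber : Graph → ℕ → Set
ChromaticNumber G c =
  Colourable G c × (∀ d → Data.Nat._<_ d c → Colourable G d → Data.Empty.⊥)
  where import Data.Empty; import Data.Nat

-- Fix a maximum clique K = {v₁, …, v_k} and let m = max {6, k}. In a diamond-free graph every
-- vertex outside K has at most one neighbour in K, so V ∖ K splits into the classes A_i of
-- vertices attached to v_i and the set Z of vertices without neighbours in K. Two vertices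
-- v_i, v_l form a P₂, so a P₄ outside K meets all but at most one of the classes.
--
-- It suffices to extend colourings from K to subsets S of V ∖ K by induction on S, and a set S
-- that is irreducible (every smaller set can be coloured, but not S) has, among others, no vertex
-- of degree < m, no vertex of Z dominated by another vertex, and no complete bipartite component.
-- For k ≥ 6 there is no P₄ outside K, and nothing irreducible is left. For k ≤ 5, a vertex outside
-- A_i sees at most one colour in A_i as long as the isolated vertices of A_i share a colour.
-- Hence once the classes are coloured, vertices of Z see few colours, and they can be coloured
-- greedily because irreducibility makes the components of Z stars and small cliques.
--
-- Tightness for k = 3 is witnessed by the intersection graph of the 27 lines on a cubic surface
-- (the complement of the Schläfli graph), and for k ≥ 6 by complete graphs.

module Submission where

open import Defs
open import Data.Nat using (ℕ; zero; suc; _+_; _⊔_; _≤_; _<_; z≤n; s≤s; _≡ᵇ_; _<ᵇ_)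
import Data.Nat.Properties as ℕ
open import Data.Bool using (Bool; true; false; not; _∧_; _∨_; if_then_else_)
import Data.Bool.Properties as Bool
open import Data.Fin using (Fin; zero; suc; #_; toℕ; fromℕ; inject≤; inject₁; combine)
open import Data.Fin.Properties using (_≟_; any?; all?; toℕ-injective; toℕ-inject₁; injective⇒≤)
open import Data.Fin.Properties using (inject₁-injective; fromℕ≢inject₁; inject≤-injective; combine-injective)
open import Data.Fin.Subset using (Subset; _∈_; _⊂_)
open import Data.Fin.Subset.Properties using (_∈?_)
open import Data.Fin.Subset.Induction using (⊂-wellFounded)
open import Data.Vec as Vec using (Vec; []; _∷_)
import Data.Vec.Properties as Vec
open import Data.List using (List; []; _∷_; _++_; length; map; filter; allFin; lookup)
open import Data.List.Properties using (length-map; length-++; length-tabulate; filter-none)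
open import Data.List.Membership.Propositional using () renaming (_∈_ to _∈ˡ_; _∉_ to _∉ˡ_)
open import Data.List.Membership.Propositional.Properties using (∈-map⁺; ∈-++⁺ˡ; ∈-++⁺ʳ; ∈-allFin; ∈-lookup; ∈-filter⁺)
import Data.List.Membership.DecPropositional as DecMem
open import Data.List.Relation.Unary.Any using (here; there; index)
open import Data.List.Relation.Unary.Any.Properties using (lookup-index)
open import Data.List.Relation.Unary.All as All using (All; []; _∷_)
import Data.List.Relation.Unary.All.Properties as All
open import Data.List.Relation.Unary.AllPairs using (AllPairs; []; _∷_)
open import Data.List.Relation.Binary.Pointwise using (Pointwise; []; _∷_)
open import Data.List.Relation.Unary.Unique.Propositional using (Unique)
import Data.List.Relation.Unary.Unique.Propositional.Properties as Unique
open import Data.Product using (Σ; ∃; ∃₂; _×_; _,_; proj₁; proj₂)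
open import Data.Sum using (_⊎_; inj₁; inj₂; [_,_]′; map₂; swap)
open import Data.Empty using (⊥; ⊥-elim)
open import Function using (_∘_; id; case_of_)
open import Function.Definitions using (Injective)
open import Induction.WellFounded using (Acc; acc)
open import Level using (0ℓ)
open import Relation.Nullary using (¬_; Dec; yes; no; contradiction; does)
open import Relation.Nullary.Decidable using (_×-dec_; _⊎-dec_; _→-dec_; ¬?; map′; from-yes)
open import Relation.Nullary.Decidable using (decidable-stable; dec-true; dec-false)
open import Relation.Unary using (Pred; Decidable)
open import Relation.Binary.Definitions using (Symmetric; tri<; tri≈; tri>)
open import Relation.Binary.PropositionalEquality using (_≡_; _≢_; refl; sym; trans; cong; cong₂; subst)

-- Finite lists and finite search

AllPairs-lookup : ∀ {A : Set} {R : A → A → Set} → Symmetric R → ∀ {L} → AllPairs R L →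
  ∀ {i j} → i ≢ j → R (lookup L i) (lookup L j)
AllPairs-lookup s (x~ ∷ c) {zero} {zero} i≢j = contradiction refl i≢j
AllPairs-lookup s (x~ ∷ c) {zero} {suc j} i≢j = All.lookup x~ (∈-lookup j)
AllPairs-lookup s (x~ ∷ c) {suc i} {zero} i≢j = s (All.lookup x~ (∈-lookup i))
AllPairs-lookup s (x~ ∷ c) {suc i} {suc j} i≢j = AllPairs-lookup s c (i≢j ∘ cong suc)

Unique-length : ∀ {t} {L : List (Fin t)} → Unique L → length L ≤ t
Unique-length {L = L} un = injective⇒≤ λ {i} {j} e →
  decidable-stable (i ≟ j) λ i≢j → AllPairs-lookup (_∘ sym) un i≢j e

fresh : ∀ {m} (L : List (Fin m)) → length L < m → ∃ λ x → x ∉ˡ L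
fresh {m} L L<m with any? (λ x → ¬? (DecMem._∈?_ _≟_ x L))
... | yes p = p
... | no all = contradiction (injective⇒≤ index-inj) (ℕ.<⇒≱ L<m)
  where
  mem : ∀ x → x ∈ˡ L
  mem x = decidable-stable (DecMem._∈?_ _≟_ x L) (λ x∉ → all (x , x∉))
  index-inj : Injective _≡_ _≡_ (index ∘ mem)
  index-inj {x} {y} eq = trans (lookup-index (mem x)) (trans (cong (lookup L) eq) (sym (lookup-index (mem y))))

fresh₂ : ∀ {m} (L : List (Fin m)) → suc (length L) < m → ∃₂ λ x y → x ≢ y × x ∉ˡ L × y ∉ˡ L
fresh₂ L L<m =
  let x , x∉ = fresh L (ℕ.<-trans (ℕ.n<1+n _) L<m)
      y , y∉ = fresh (x ∷ L) L<m
  in x , y , (λ x≡y → y∉ (here (sym x≡y))) , x∉ , y∉ ∘ there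

-- Functions are enumerated only up to pointwise equality, hence the argument `ext`. Deciding
-- colourability in this way allows the upper bound to be proved under a double negation.
decFun : ∀ {m} k {P : (Fin k → Fin m) → Set} →
  (∀ {f g} → (∀ i → f i ≡ g i) → P f → P g) → Decidable P → Dec (∃ P)
decFun zero ext P? = map′ (λ p → _ , p) (λ (f , p) → ext (λ ()) p) (P? (λ ()))
decFun {m} (suc k) {P} ext P? =
  map′ (λ (x , f , p) → cons x f , p)
       (λ (f , p) → f zero , f ∘ suc , ext (λ { zero → refl ; (suc i) → refl }) p)
       (any? λ x → decFun k (λ eq → ext (λ { zero → refl ; (suc i) → eq i })) (λ f → P? (cons x f)))
  where
  cons : Fin m → (Fin k → Fin m) → Fin (suc k) → Fin m
  cons x f zero = x
  cons x f (suc i) = f i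

Colourable? : ∀ G m → Dec (Colourable G m)
Colourable? G m = decFun (n G) (λ eq p u w u~w e → p u w u~w (trans (eq u) (trans e (sym (eq w)))))
  λ col → all? λ u → all? λ w → (adj G u w Bool.≟ true) →-dec ¬? (col u ≟ col w)

-- Adjacency, cliques and forbidden induced subgraphs

module Adjacency (G : Graph) where

  V : Set
  V = Fin (n G)

  infix 4 _~_ _≁_ _~?_
  _~_ _≁_ : V → V → Set
  u ~ w = adj G u w ≡ true
  u ≁ w = adj G u w ≡ false

  _~?_ : ∀ u w → Dec (u ~ w)
  u ~? w = adj G u w Bool.≟ true

  ~-sym : ∀ {u w} → u ~ w → w ~ u
  ~-sym {u} {w} = trans (adj-sym G w u)

  ≁-sym : ∀ {u w} → u ≁ w → w ≁ u
  ≁-sym {u} {w} = trans (adj-sym G w u)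

  ~≁ : ∀ {u w} {A : Set} → u ~ w → u ≁ w → A
  ~≁ p q = case trans (sym p) q of λ ()

  ~⇒≢ : ∀ {u w} → u ~ w → u ≢ w
  ~⇒≢ {u} u~w refl = ~≁ u~w (adj-irrefl G u)

  ≁-refl : ∀ {u} → u ≁ u
  ≁-refl = adj-irrefl G _

  ~-or-≁ : ∀ u w → u ~ w ⊎ u ≁ w
  ~-or-≁ u w with adj G u w
  ... | true = inj₁ refl
  ... | false = inj₂ refl

  ≁-intro : ∀ {u w} → ¬ u ~ w → u ≁ w
  ≁-intro {u} {w} ¬p = [ (λ p → contradiction p ¬p) , id ]′ (~-or-≁ u w)

  P4 : V → V → V → V → Set
  P4 p q r s = (p ~ q × q ~ r × r ~ s) × (p ≁ r × p ≁ s × q ≁ s)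

  Clique : List V → Set
  Clique = AllPairs _~_

  hasClique : ∀ {k} (f : Fin k → V) → (∀ a b → a ≢ b → f a ~ f b) → HasClique G k
  hasClique f f-adj = f , f-inj , f-adj
    where
    f-inj : Injective _≡_ _≡_ f
    f-inj {a} {b} eq with a ≟ b
    ... | yes a≡b = a≡b
    ... | no a≢b = contradiction eq (~⇒≢ (f-adj a b a≢b))

  Clique⇒HasClique : ∀ {L j} → Clique L → j ≤ length L → HasClique G j
  Clique⇒HasClique {L} c j≤ = hasClique (λ i → lookup L (inject≤ i j≤))
    λ a b a≢b → AllPairs-lookup ~-sym c (a≢b ∘ inject≤-injective j≤ j≤ a b)

  Unique⇒Clique : ∀ {P : Pred V 0ℓ} → (∀ {u w} → P u → P w → u ≢ w → u ~ w) →
    ∀ {L} → Unique L → All P L → Clique L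
  Unique⇒Clique adjP [] [] = []
  Unique⇒Clique adjP (x≢ ∷ un) (px ∷ pxs) =
    All.zipWith (λ (pw , x≢w) → adjP px pw x≢w) (pxs , x≢) ∷ Unique⇒Clique adjP un pxs

  vertices : ∀ {P : Pred V 0ℓ} → Decidable P → List V
  vertices P? = filter P? (allFin (n G))

  ∈-vertices : ∀ {P : Pred V 0ℓ} (P? : Decidable P) {w} → P w → w ∈ˡ vertices P?
  ∈-vertices P? p = ∈-filter⁺ P? (∈-allFin _) p

  All-vertices : ∀ {P : Pred V 0ℓ} (P? : Decidable P) → All P (vertices P?)
  All-vertices P? = All.all-filter P? (allFin (n G))

  vertices-clique : ∀ {P : Pred V 0ℓ} (P? : Decidable P) →
    (∀ {u w} → P u → P w → u ≢ w → u ~ w) → Clique (vertices P?)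
  vertices-clique P? adjP = Unique⇒Clique adjP (Unique.filter⁺ P? (Unique.allFin⁺ (n G))) (All-vertices P?)

  Diamond-free P2+P4-free : Set
  Diamond-free = ∀ {u u′ w x} → u ~ u′ → w ~ u → w ~ u′ → x ~ u → x ~ u′ → w ≢ x → w ~ x
  P2+P4-free = ∀ {u u′ p q r s} → u ~ u′ → P4 p q r s →
    (∀ {x} → x ∈ˡ (p ∷ q ∷ r ∷ s ∷ []) → x ≁ u × x ≁ u′) → ⊥

  diamond-free : Free G K4-e → Diamond-free
  diamond-free free {u} {u′} {w} {x} u~u′ w~u w~u′ x~u x~u′ w≢x with ~-or-≁ w x
  ... | inj₁ w~x = w~x
  ... | inj₂ w≁x = ⊥-elim (free (f , f-inj , f-adj))
    where
    f : Fin 4 → V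
    f = Vec.lookup (u ∷ u′ ∷ w ∷ x ∷ [])
    f-adj : ∀ i j → adj G (f i) (f j) ≡ adj K4-e i j
    f-adj zero zero = ≁-refl
    f-adj zero (suc zero) = u~u′
    f-adj zero (suc (suc zero)) = ~-sym w~u
    f-adj zero (suc (suc (suc zero))) = ~-sym x~u
    f-adj (suc zero) zero = ~-sym u~u′
    f-adj (suc zero) (suc zero) = ≁-refl
    f-adj (suc zero) (suc (suc zero)) = ~-sym w~u′
    f-adj (suc zero) (suc (suc (suc zero))) = ~-sym x~u′
    f-adj (suc (suc zero)) zero = w~u
    f-adj (suc (suc zero)) (suc zero) = w~u′
    f-adj (suc (suc zero)) (suc (suc zero)) = ≁-refl
    f-adj (suc (suc zero)) (suc (suc (suc zero))) = w≁x
    f-adj (suc (suc (suc zero))) zero = x~u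
    f-adj (suc (suc (suc zero))) (suc zero) = x~u′
    f-adj (suc (suc (suc zero))) (suc (suc zero)) = ≁-sym w≁x
    f-adj (suc (suc (suc zero))) (suc (suc (suc zero))) = ≁-refl
    f-inj : Injective _≡_ _≡_ f
    f-inj {i} {j} eq = decide i j (λ l → trans (sym (f-adj i l)) (trans (cong (λ y → adj G y (f l)) eq) (f-adj j l))) eq
      where
      -- The only two vertices of the diamond with equal neighbourhoods are 2 and 3.
      decide : ∀ i j → (∀ l → adj K4-e i l ≡ adj K4-e j l) → f i ≡ f j → i ≡ j
      decide (suc (suc zero)) (suc (suc (suc zero))) _ e = contradiction e w≢x
      decide (suc (suc (suc zero))) (suc (suc zero)) _ e = contradiction (sym e) w≢x
      decide zero zero _ _ = refl
      decide zero (suc zero) t _ = case t zero of λ ()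
      decide zero (suc (suc zero)) t _ = case t zero of λ ()
      decide zero (suc (suc (suc zero))) t _ = case t zero of λ ()
      decide (suc zero) zero t _ = case t zero of λ ()
      decide (suc zero) (suc zero) _ _ = refl
      decide (suc zero) (suc (suc zero)) t _ = case t (suc zero) of λ ()
      decide (suc zero) (suc (suc (suc zero))) t _ = case t (suc zero) of λ ()
      decide (suc (suc zero)) zero t _ = case t zero of λ ()
      decide (suc (suc zero)) (suc zero) t _ = case t (suc zero) of λ ()
      decide (suc (suc zero)) (suc (suc zero)) _ _ = refl
      decide (suc (suc (suc zero))) zero t _ = case t zero of λ ()
      decide (suc (suc (suc zero))) (suc zero) t _ = case t (suc zero) of λ ()
      decide (suc (suc (suc zero))) (suc (suc (suc zero))) _ _ = refl

  p2+p4-free : Free G P2+P4 → P2+P4-free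
  p2+p4-free free {u} {u′} {p} {q} {r} {s} u~u′ ((p~q , q~r , r~s) , (p≁r , p≁s , q≁s)) far =
    free (f , f-inj , f-adj)
    where
    f : Fin 6 → V
    f = Vec.lookup (u ∷ u′ ∷ p ∷ q ∷ r ∷ s ∷ [])
    upper : ∀ i j → toℕ i < toℕ j → adj G (f i) (f j) ≡ adj P2+P4 i j
    upper zero (suc zero) _ = u~u′
    upper zero (suc (suc zero)) _ = ≁-sym (proj₁ (far (here refl)))
    upper zero (suc (suc (suc zero))) _ = ≁-sym (proj₁ (far (there (here refl))))
    upper zero (suc (suc (suc (suc zero)))) _ = ≁-sym (proj₁ (far (there (there (here refl)))))
    upper zero (suc (suc (suc (suc (suc zero))))) _ = ≁-sym (proj₁ (far (there (there (there (here refl))))))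
    upper (suc zero) (suc (suc zero)) _ = ≁-sym (proj₂ (far (here refl)))
    upper (suc zero) (suc (suc (suc zero))) _ = ≁-sym (proj₂ (far (there (here refl))))
    upper (suc zero) (suc (suc (suc (suc zero)))) _ = ≁-sym (proj₂ (far (there (there (here refl)))))
    upper (suc zero) (suc (suc (suc (suc (suc zero))))) _ = ≁-sym (proj₂ (far (there (there (there (here refl))))))
    upper (suc (suc zero)) (suc (suc (suc zero))) _ = p~q
    upper (suc (suc zero)) (suc (suc (suc (suc zero)))) _ = p≁r
    upper (suc (suc zero)) (suc (suc (suc (suc (suc zero))))) _ = p≁s
    upper (suc (suc (suc zero))) (suc (suc (suc (suc zero)))) _ = q~r
    upper (suc (suc (suc zero))) (suc (suc (suc (suc (suc zero))))) _ = q≁s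
    upper (suc (suc (suc (suc zero)))) (suc (suc (suc (suc (suc zero))))) _ = r~s
    upper (suc _) (suc zero) (s≤s ())
    upper (suc (suc _)) (suc (suc zero)) (s≤s (s≤s ()))
    upper (suc (suc (suc _))) (suc (suc (suc zero))) (s≤s (s≤s (s≤s ())))
    upper (suc (suc (suc (suc _)))) (suc (suc (suc (suc zero)))) (s≤s (s≤s (s≤s (s≤s ()))))
    upper (suc (suc (suc (suc (suc _))))) (suc (suc (suc (suc (suc zero))))) (s≤s (s≤s (s≤s (s≤s (s≤s ())))))
    f-adj : ∀ i j → adj G (f i) (f j) ≡ adj P2+P4 i j
    f-adj i j with ℕ.<-cmp (toℕ i) (toℕ j)
    ... | tri< i<j _ _ = upper i j i<j
    ... | tri> _ _ j<i = trans (adj-sym G (f i) (f j)) (trans (upper j i j<i) (adj-sym P2+P4 j i))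
    ... | tri≈ _ i≡j _ with toℕ-injective i≡j
    ...   | refl = trans ≁-refl (sym (adj-irrefl P2+P4 i))
    -- No two vertices of `P2+P4` have the same neighbourhood, so injectivity of `f` follows from
    -- `f-adj`.
    twins : ∀ i j → (∀ l → adj P2+P4 i l ≡ adj P2+P4 j l) → i ≡ j
    twins = from-yes (all? λ i → all? λ j →
      all? (λ l → adj P2+P4 i l Bool.≟ adj P2+P4 j l) →-dec (i ≟ j))
    f-inj : Injective _≡_ _≡_ f
    f-inj {i} {j} eq = twins i j λ l →
      trans (sym (f-adj i l)) (trans (cong (λ y → adj G y (f l)) eq) (f-adj j l))

module _ {k : ℕ} {P : Pred (Fin k) 0ℓ} (P? : Decidable P) where

  subset : Subset k
  subset = Vec.tabulate (does ∘ P?)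

  ∈-subset⁺ : ∀ {x} → P x → x ∈ subset
  ∈-subset⁺ {x} p = Vec.lookup⇒[]= x _ (trans (Vec.lookup∘tabulate _ x) (dec-true (P? x) p))

  ∈-subset⁻ : ∀ {x} → x ∈ subset → P x
  ∈-subset⁻ {x} x∈ = decidable-stable (P? x) λ ¬p →
    case trans (sym (dec-false (P? x) ¬p)) (trans (sym (Vec.lookup∘tabulate _ x)) (Vec.[]=⇒lookup x∈)) of λ ()

-- The cyclic shift. Colouring K by a shifted copy of the class colours keeps it injective and gives
-- each clique vertex a colour different from that of its own class.
rotate : ∀ {n} → Fin (suc n) → Fin (suc n)
rotate zero = fromℕ _
rotate (suc i) = inject₁ i

rotate-injective : ∀ {n} → Injective _≡_ _≡_ (rotate {n})
rotate-injective {x = zero} {zero} e = refl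
rotate-injective {x = zero} {suc i} e = contradiction e fromℕ≢inject₁
rotate-injective {x = suc i} {zero} e = contradiction (sym e) fromℕ≢inject₁
rotate-injective {x = suc i} {suc i′} e = cong suc (inject₁-injective e)

rotate-≢ : ∀ {n} (i : Fin (2 + n)) → rotate i ≢ i
rotate-≢ zero ()
rotate-≢ (suc i) e = ℕ.1+n≢n (trans (sym (cong toℕ e)) (toℕ-inject₁ i))

-- Partial colourings

module Colouring (G : Graph) (m : ℕ) where
  open Adjacency G

  Proper : Pred V 0ℓ → (V → Fin m) → Set
  Proper D c = ∀ {u w} → D u → D w → u ~ w → c u ≢ c w

  AgreeOn : Pred V 0ℓ → (c c′ : V → Fin m) → Set
  AgreeOn D c c′ = ∀ {w} → D w → c′ w ≡ c w

  _[_↦_] : (V → Fin m) → V → Fin m → V → Fin m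
  (c [ x ↦ a ]) w with w ≟ x
  ... | yes _ = a
  ... | no _ = c w

  [↦]-same : ∀ c x a → (c [ x ↦ a ]) x ≡ a
  [↦]-same c x a with x ≟ x
  ... | yes _ = refl
  ... | no x≢x = contradiction refl x≢x

  [↦]-other : ∀ c {x w} a → w ≢ x → (c [ x ↦ a ]) w ≡ c w
  [↦]-other c {x} {w} a w≢x with w ≟ x
  ... | yes w≡x = contradiction w≡x w≢x
  ... | no _ = refl

  proper-insert : ∀ {D c} x a → Proper D c → (∀ {w} → D w → w ~ x → c w ≢ a) →
    Proper (λ w → D w ⊎ w ≡ x) (c [ x ↦ a ])
  proper-insert x a p free {u} {w} du dw u~w with u ≟ x | w ≟ x
  ... | yes refl | yes refl = contradiction refl (~⇒≢ u~w)
  proper-insert x a p free du (inj₁ dw) u~w | yes refl | no _ = free dw (~-sym u~w) ∘ sym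
  proper-insert x a p free du (inj₂ e) u~w | yes refl | no w≢x = contradiction e w≢x
  proper-insert x a p free (inj₁ du) dw u~w | no _ | yes refl = free du u~w
  proper-insert x a p free (inj₂ e) dw u~w | no u≢x | yes refl = contradiction e u≢x
  proper-insert x a p free (inj₁ du) (inj₁ dw) u~w | no _ | no _ = p du dw u~w
  proper-insert x a p free (inj₂ e) dw u~w | no u≢x | no _ = contradiction e u≢x
  proper-insert x a p free (inj₁ du) (inj₂ e) u~w | no _ | no w≢x = contradiction e w≢x

  -- The list `L` covers all neighbours in `D` and `U`, coloured already or not, and exists for
  -- every extension of `c`. Hence the order in which `U` is processed does not matter.
  greedy : ∀ {D U : Pred V 0ℓ} {c} → Decidable U → (∀ {w} → U w → ¬ D w) → Proper D c →
    (∀ c′ → AgreeOn D c c′ → ∀ {u} → U u →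
      ∃ λ L → length L < m × (∀ {w} → D w ⊎ U w → w ~ u → c′ w ∈ˡ L)) →
    ∃ λ c′ → AgreeOn D c c′ × Proper (λ w → D w ⊎ U w) c′
  greedy {D} {U} {c} U? disjoint p seen =
    let c′ , agree , p′ = colourList (All-vertices U?)
    in c′ , agree , λ du dw → p′ (weaken du) (weaken dw)
    where
    weaken : ∀ {w} → D w ⊎ U w → D w ⊎ w ∈ˡ vertices U?
    weaken (inj₁ d) = inj₁ d
    weaken (inj₂ u) = inj₂ (∈-vertices U? u)
    colourList : ∀ {us} → All U us → ∃ λ c′ → AgreeOn D c c′ × Proper (λ w → D w ⊎ w ∈ˡ us) c′
    colourList [] = c , (λ _ → refl) , λ { (inj₁ du) (inj₁ dw) → p du dw }
    colourList {u ∷ us} (uu ∷ uus) with colourList uus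
    ... | c′ , agree , p′ with seen c′ agree uu
    ...   | L , L<m , L∋ with fresh L L<m
    ...     | a , a∉ =
      c′ [ u ↦ a ] ,
      (λ dw → trans ([↦]-other c′ a λ { refl → disjoint uu dw }) (agree dw)) ,
      λ du dw → proper-insert u a p′ free (split du) (split dw)
      where
      free : ∀ {w} → D w ⊎ w ∈ˡ us → w ~ u → c′ w ≢ a
      free dw w~u refl = a∉ (L∋ ([ inj₁ , inj₂ ∘ All.lookup uus ]′ dw) w~u)
      split : ∀ {w} → D w ⊎ w ∈ˡ (u ∷ us) → (D w ⊎ w ∈ˡ us) ⊎ w ≡ u
      split (inj₁ d) = inj₁ (inj₁ d)
      split (inj₂ (here e)) = inj₂ e
      split (inj₂ (there w∈)) = inj₁ (inj₂ w∈)

-- The classes attached to a maximum clique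

module MaximumClique (G : Graph)
  (diamond : Adjacency.Diamond-free G) (p2+p4 : Adjacency.P2+P4-free G)
  (j : ℕ) (v : Fin (3 + j) → Fin (n G)) (v-inj : Injective _≡_ _≡_ v)
  (v-adj : ∀ i i′ → i ≢ i′ → adj G (v i) (v i′) ≡ true) (maximum : ¬ HasClique G (4 + j)) where

  open Adjacency G

  InK Outside : Pred V 0ℓ
  InK w = ∃ λ i → w ≡ v i
  Outside w = ¬ InK w

  InK? : Decidable InK
  InK? w = any? λ i → w ≟ v i

  clique-bound : ∀ {L} → Clique L → length L ≤ 3 + j
  clique-bound c = ℕ.≮⇒≥ λ k< → maximum (Clique⇒HasClique c k<)

  -- With two neighbours in K, diamond-freeness makes `w` adjacent to all of K, which would enlarge
  -- the maximum clique.
  tag-unique : ∀ {w i i′} → Outside w → w ~ v i → w ~ v i′ → i ≡ i′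
  tag-unique {w} {i} {i′} out w~i w~i′ with i ≟ i′
  ... | yes i≡i′ = i≡i′
  ... | no i≢i′ = contradiction (hasClique f f-adj) maximum
    where
    w~v : ∀ l → w ~ v l
    w~v l with l ≟ i | l ≟ i′
    ... | yes refl | _ = w~i
    ... | no _ | yes refl = w~i′
    ... | no l≢i | no l≢i′ =
      diamond (v-adj i i′ i≢i′) w~i w~i′ (v-adj l i l≢i) (v-adj l i′ l≢i′) (λ e → out (l , e))
    f : Fin (4 + j) → V
    f zero = w
    f (suc l) = v l
    f-adj : ∀ a b → a ≢ b → f a ~ f b
    f-adj zero zero a≢b = contradiction refl a≢b
    f-adj zero (suc b) _ = w~v b
    f-adj (suc a) zero _ = ~-sym (w~v a)
    f-adj (suc a) (suc b) a≢b = v-adj a b (a≢b ∘ cong suc)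

  abstract
    -- Junk value zero if w has no neighbour in K.
    tag : V → Fin (3 + j)
    tag w with any? (λ i → w ~? v i)
    ... | yes (i , _) = i
    ... | no _ = zero

    tag-adj : ∀ {w i} → w ~ v i → w ~ v (tag w)
    tag-adj {w} w~i with any? (λ i → w ~? v i)
    ... | yes (_ , p) = p
    ... | no none = contradiction (_ , w~i) none

  tag-spec : ∀ {w i} → Outside w → w ~ v i → tag w ≡ i
  tag-spec out w~i = tag-unique out (tag-adj w~i) w~i

  -- Vacuous if `w` has no neighbour in K, so such vertices add nothing to the list of classes that
  -- a path meets.
  TagIn : List (Fin (3 + j)) → V → Set
  TagIn T w = ∀ {i} → w ~ v i → i ∈ˡ T

  -- Two clique vertices with indices outside T form the P2.
  noP4 : ∀ {p q r s} T → length T ≤ suc j → P4 p q r s →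
    TagIn T p → TagIn T q → TagIn T r → TagIn T s → ⊥
  noP4 T T≤ path tp tq tr ts =
    let a , b , a≢b , a∉ , b∉ = fresh₂ T (s≤s (s≤s T≤))
        far : ∀ {x} → TagIn T x → x ≁ v a × x ≁ v b
        far tx = ≁-intro (a∉ ∘ tx) , ≁-intro (b∉ ∘ tx)
    in p2+p4 (v-adj a b a≢b) path λ
      { (here refl) → far tp
      ; (there (here refl)) → far tq
      ; (there (there (here refl))) → far tr
      ; (there (there (there (here refl)))) → far ts }

  closeP4 : ∀ {p q r s} T → length T ≤ suc j → p ~ q → q ~ r → r ~ s → p ≁ r → q ≁ s →
    TagIn T p → TagIn T q → TagIn T r → TagIn T s → p ~ s
  closeP4 {p} {s = s} T T≤ pq qr rs pr qs tp tq tr ts with ~-or-≁ p s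
  ... | inj₁ p~s = p~s
  ... | inj₂ p≁s = ⊥-elim (noP4 T T≤ ((pq , qr , rs) , (pr , p≁s , qs)) tp tq tr ts)

  module Colours (m : ℕ) where
    open Colouring G m public

    Domain : Subset (n G) → Pred V 0ℓ
    Domain S w = InK w ⊎ w ∈ S

    Good : Subset (n G) → Set
    Good S = ∃ (Proper (Domain S))

  module Irreducible (m : ℕ) (k≤m : 3 + j ≤ m) (4≤m : 4 ≤ m)
    (S : Subset (n G)) (outside : ∀ {w} → w ∈ S → Outside w)
    (smaller : ∀ S′ → S′ ⊂ S → ¬ ¬ Colours.Good m S′) (bad : ¬ Colours.Good m S) where

    open Colours m

    -- Reducible configurations

    -- The vertex `x` makes `S` without `U` strictly smaller than `S`, hence colourable together
    -- with K; `bad` rules out that such a colouring extends.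
    reduce : ∀ {U : Pred V 0ℓ} → Decidable U → ∀ {x} → x ∈ S → U x →
      (∀ c → Proper (λ w → InK w ⊎ w ∈ S × ¬ U w) c → Good S) → ⊥
    reduce {U} U? {x} x∈S ux extend =
      smaller (subset P?) (proj₁ ∘ ∈-subset⁻ P? , x , x∈S , λ x∈ → proj₂ (∈-subset⁻ P? x∈) ux)
        λ (c , p) → bad (extend c λ du dw → p (strengthen du) (strengthen dw))
      where
      P? : Decidable (λ w → w ∈ S × ¬ U w)
      P? w = (w ∈? S) ×-dec ¬? (U? w)
      strengthen : ∀ {w} → InK w ⊎ w ∈ S × ¬ U w → InK w ⊎ w ∈ subset P?
      strengthen = map₂ (∈-subset⁺ P?)

    tagIn-tag : ∀ {T w} → w ∈ S → tag w ∈ˡ T → TagIn T w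
    tagIn-tag w∈S t∈ w~i = subst (_∈ˡ _) (tag-spec (outside w∈S) w~i) t∈

    tagIn : ∀ {T w i} → w ∈ S → w ~ v i → i ∈ˡ T → TagIn T w
    tagIn w∈S w~i i∈ w~i′ = subst (_∈ˡ _) (tag-unique (outside w∈S) w~i w~i′) i∈

    Tagless : Pred V 0ℓ
    Tagless w = ∀ i → w ≁ v i

    tagIn-tagless : ∀ {T w} → Tagless w → TagIn T w
    tagIn-tagless tl w~i = ~≁ w~i (tl _)

    nbr? : ∀ x → Decidable (λ w → w ∈ S × w ~ x)
    nbr? x w = (w ∈? S) ×-dec (w ~? x)

    nbrs : V → List V
    nbrs x = vertices (nbr? x)

    reduce-vertex : ∀ {x} → x ∈ S → (∀ c → Proper (λ w → InK w ⊎ w ∈ S × w ≢ x) c →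
      ∃ λ a → ∀ {w} → InK w ⊎ w ∈ S × w ≢ x → w ~ x → c w ≢ a) → ⊥
    reduce-vertex {x} x∈S free = reduce (_≟ x) x∈S refl λ c p →
      let a , a-free = free c p
      in c [ x ↦ a ] , λ du dw → proper-insert x a p a-free (split du) (split dw)
      where
      split : ∀ {w} → Domain S w → (InK w ⊎ w ∈ S × w ≢ x) ⊎ w ≡ x
      split (inj₁ k) = inj₁ (inj₁ k)
      split {w} (inj₂ w∈S) with w ≟ x
      ... | yes e = inj₂ e
      ... | no w≢x = inj₁ (inj₂ (w∈S , w≢x))

    -- Besides `nbrs x`, only one vertex of K can be adjacent to `x`, which accounts for the `suc`.
    -- If there is none, `v (tag x)` merely wastes an entry.
    low-degree : ∀ {x} → x ∈ S → suc (length (nbrs x)) < m → ⊥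
    low-degree {x} x∈S deg<m = reduce-vertex x∈S λ c _ →
      let a , a∉ = fresh (c (v (tag x)) ∷ map c (nbrs x)) (subst (λ l → suc l < m) (sym (length-map c (nbrs x))) deg<m)
      in a , λ dw w~x e → a∉ (subst (_∈ˡ _) e (seen c dw w~x))
      where
      seen : ∀ c {w} → InK w ⊎ w ∈ S × w ≢ x → w ~ x → c w ∈ˡ c (v (tag x)) ∷ map c (nbrs x)
      seen c (inj₁ (i , refl)) w~x = here (cong (c ∘ v) (sym (tag-spec (outside x∈S) (~-sym w~x))))
      seen c (inj₂ (w∈S , _)) w~x = there (∈-map⁺ c (∈-vertices (nbr? x) (w∈S , w~x)))

    has-nbr : ∀ {x} → x ∈ S → ∃ λ y → y ∈ S × y ~ x
    has-nbr {x} x∈S with any? (nbr? x)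
    ... | yes p = p
    ... | no none = ⊥-elim (low-degree x∈S (subst (λ L → suc (length L) < m)
      (sym (filter-none (nbr? x) {xs = allFin (n G)} (All.tabulate λ {w} _ p → none (w , p)))) (ℕ.≤-trans (s≤s (s≤s z≤n)) 4≤m)))

    -- For adjacent `x` and `y`, a private neighbour `p` of `x`: the vertices `p`, `x`, `y` form an
    -- induced path.
    Out : V → V → Set
    Out x y = ∃ λ p → (p ∈ S × p ~ x) × p ≢ y × p ≁ y

    Out? : ∀ x y → Dec (Out x y)
    Out? x y = any? λ p → nbr? x p ×-dec (¬? (p ≟ y) ×-dec (adj G p y Bool.≟ false))

    ¬Out⇒~ : ∀ {x y p} → ¬ Out x y → p ∈ S → p ~ x → p ≢ y → p ~ y
    ¬Out⇒~ {y = y} {p} ¬out p∈S p~x p≢y with ~-or-≁ p y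
    ... | inj₁ p~y = p~y
    ... | inj₂ p≁y = contradiction (p , (p∈S , p~x) , p≢y , p≁y) ¬out

    -- Every neighbour of `x` in `S` other than `y` is a common neighbour of `x` and `y`, and the
    -- common neighbours of an edge are pairwise adjacent in a diamond-free graph.
    ¬Out⇒clique : ∀ {x y} → x ~ y → ¬ Out x y →
      ∀ {p q} → p ∈ S × p ~ x → q ∈ S × q ~ x → p ≢ q → p ~ q
    ¬Out⇒clique {x} {y} x~y ¬out {p} {q} (p∈S , p~x) (q∈S , q~x) p≢q with p ≟ y | q ≟ y
    ... | yes refl | _ = ~-sym (¬Out⇒~ ¬out q∈S q~x (p≢q ∘ sym))
    ... | no p≢y | yes refl = ¬Out⇒~ ¬out p∈S p~x p≢y
    ... | no p≢y | no q≢y = diamond x~y p~x (¬Out⇒~ ¬out p∈S p~x p≢y) q~x (¬Out⇒~ ¬out q∈S q~x q≢y) p≢q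

    -- Otherwise `x` and `nbrs x` form a clique, of order at most `3 + j`, and `x` has low degree.
    outward : 3 + j < m → ∀ {x y} → x ∈ S → x ~ y → Out x y
    outward k<m {x} {y} x∈S x~y = decidable-stable (Out? x y) λ ¬out →
      low-degree x∈S (ℕ.≤-<-trans (clique-bound
        (All.map (λ (_ , w~x) → ~-sym w~x) (All-vertices (nbr? x)) ∷
         vertices-clique (nbr? x) (¬Out⇒clique x~y ¬out))) k<m)

    -- The colour of `w` can be reused for `z`: no vertex of K is adjacent to `z`, and its
    -- neighbours in `S` already avoid that colour.
    comparable : ∀ {z w} → z ∈ S → Tagless z → w ∈ S → w ≢ z →
      (∀ {p} → p ∈ S → p ~ z → p ~ w) → ⊥
    comparable {z} {w} z∈S tl w∈S w≢z sub = reduce-vertex z∈S λ c p → c w ,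
      λ { (inj₁ (i , refl)) vi~z → ~≁ (~-sym vi~z) (tl i)
        ; (inj₂ (u∈S , u≢z)) u~z → p (inj₂ (u∈S , u≢z)) (inj₂ (w∈S , w≢z)) (sub u∈S u~z) }

    Blocked : (V → Fin m) → V → Fin m → Set
    Blocked c w a = w ~ v (tag w) × c (v (tag w)) ≡ a

    Blocked? : ∀ c w a → Dec (Blocked c w a)
    Blocked? c w a = (w ~? v (tag w)) ×-dec (c (v (tag w)) ≟ a)

    blocked : ∀ c {w i} → w ∈ S → w ~ v i → Blocked c w (c (v i))
    blocked c w∈S w~i = tag-adj w~i , cong (c ∘ v) (tag-spec (outside w∈S) w~i)

    -- If some `v i` is adjacent to both, then `v i`, `x` and `nbrs x` form a clique and `x` has low
    -- degree. Otherwise both vertices are removed. Their common neighbours in `S` form a clique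
    -- with them, so two colours are missing there, and K forbids at most one colour at each of `x`
    -- and `y`, never the same one at both.
    simplicial-pair : ∀ {x y} → x ∈ S → y ∈ S → x ~ y → ¬ Out x y → ¬ Out y x → ⊥
    simplicial-pair {x} {y} x∈S y∈S x~y ¬out-x ¬out-y with any? (λ i → (x ~? v i) ×-dec (y ~? v i))
    ... | yes (i , x~i , y~i) = low-degree x∈S (ℕ.≤-trans (clique-bound
      ((~-sym x~i ∷ All.map (λ (w∈S , w~x) → ~-sym (v-nbr w∈S w~x)) (All-vertices (nbr? x))) ∷
       All.map (λ (_ , w~x) → ~-sym w~x) (All-vertices (nbr? x)) ∷
       vertices-clique (nbr? x) (¬Out⇒clique x~y ¬out-x))) k≤m)
      where
      v-nbr : ∀ {w} → w ∈ S → w ~ x → w ~ v i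
      v-nbr {w} w∈S w~x with w ≟ y
      ... | yes refl = y~i
      ... | no w≢y = diamond x~y w~x (¬Out⇒~ ¬out-x w∈S w~x w≢y) (~-sym x~i) (~-sym y~i)
        λ e → outside w∈S (i , e)
    ... | no no-common = reduce (λ w → (w ≟ x) ⊎-dec (w ≟ y)) x∈S (inj₁ refl) recolour
      where
      common? : Decidable (λ w → w ∈ S × w ~ x × w ~ y)
      common? w = (w ∈? S) ×-dec ((w ~? x) ×-dec (w ~? y))
      N : List V
      N = vertices common?
      N-bound : 2 + length N ≤ 3 + j
      N-bound = clique-bound
        ((x~y ∷ All.map (λ (_ , w~x , _) → ~-sym w~x) (All-vertices common?)) ∷
         All.map (λ (_ , _ , w~y) → ~-sym w~y) (All-vertices common?) ∷
         vertices-clique common? λ (_ , u~x , u~y) (_ , w~x , w~y) → diamond x~y u~x u~y w~x w~y)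
      Rest : Pred V 0ℓ
      Rest w = InK w ⊎ w ∈ S × ¬ (w ≡ x ⊎ w ≡ y)
      module _ (c : V → Fin m) (p : Proper Rest c) where
        blocked-distinct : ∀ {a} → Blocked c x a → Blocked c y a → ⊥
        blocked-distinct (x~ , cx) (y~ , cy) with tag x ≟ tag y
        ... | yes e = no-common (tag x , x~ , subst (λ i → y ~ v i) (sym e) y~)
        ... | no ≢ = p (inj₁ (_ , refl)) (inj₁ (_ , refl)) (v-adj _ _ ≢) (trans cx (sym cy))
        assign : ∀ {a b} → a ≢ b → a ∉ˡ map c N → b ∉ˡ map c N →
          ¬ Blocked c x a → ¬ Blocked c y b → Good S
        assign {a} {b} a≢b a∉ b∉ ¬x ¬y =
          (c [ x ↦ a ]) [ y ↦ b ] , λ du dw → proper-insert y b (proper-insert x a p free-x) free-y (split du) (split dw)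
          where
          free-x : ∀ {w} → Rest w → w ~ x → c w ≢ a
          free-x (inj₁ (i , refl)) w~x refl = ¬x (blocked c x∈S (~-sym w~x))
          free-x (inj₂ (w∈S , w≢)) w~x refl =
            a∉ (∈-map⁺ c (∈-vertices common? (w∈S , w~x , ¬Out⇒~ ¬out-x w∈S w~x (w≢ ∘ inj₂))))
          free-y′ : ∀ {w} → Rest w → w ~ y → c w ≢ b
          free-y′ (inj₁ (i , refl)) w~y refl = ¬y (blocked c y∈S (~-sym w~y))
          free-y′ (inj₂ (w∈S , w≢)) w~y refl =
            b∉ (∈-map⁺ c (∈-vertices common? (w∈S , ¬Out⇒~ ¬out-y w∈S w~y (w≢ ∘ inj₁) , w~y)))
          rest≢x : ∀ {w} → Rest w → w ≢ x
          rest≢x (inj₁ k) refl = outside x∈S k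
          rest≢x (inj₂ (_ , w≢)) = w≢ ∘ inj₁
          free-y : ∀ {w} → Rest w ⊎ w ≡ x → w ~ y → (c [ x ↦ a ]) w ≢ b
          free-y (inj₁ r) w~y e = free-y′ r w~y (trans (sym ([↦]-other c a (rest≢x r))) e)
          free-y (inj₂ refl) _ e = a≢b (trans (sym ([↦]-same c x a)) e)
          split : ∀ {w} → Domain S w → (Rest w ⊎ w ≡ x) ⊎ w ≡ y
          split (inj₁ k) = inj₁ (inj₁ (inj₁ k))
          split {w} (inj₂ w∈S) with w ≟ x | w ≟ y
          ... | yes e | _ = inj₁ (inj₂ e)
          ... | no _ | yes e = inj₂ e
          ... | no w≢x | no w≢y = inj₁ (inj₁ (inj₂ (w∈S , [ w≢x , w≢y ]′)))
        -- Distinct colours are blocked at x and y, so one of the two assignments of a and b works.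
        recolour : Good S
        recolour with fresh₂ (map c N) (subst (λ l → suc l < m) (sym (length-map c N)) (ℕ.≤-trans N-bound k≤m))
        ... | a , b , a≢b , a∉ , b∉ with Blocked? c x a | Blocked? c y b
        ...   | no ¬xa | no ¬yb = assign a≢b a∉ b∉ ¬xa ¬yb
        ...   | yes xa | _ = assign (a≢b ∘ sym) b∉ a∉ (λ xb → a≢b (trans (sym (proj₂ xa)) (proj₂ xb))) (blocked-distinct xa)
        ...   | no _ | yes yb = assign (a≢b ∘ sym) b∉ a∉ (λ xb → blocked-distinct xb yb)
          (λ ya → a≢b (trans (sym (proj₂ ya)) (proj₂ yb)))

    -- The neighbours of `x` and `y` form a bipartite component of `S`. Each side has its own
    -- palette of two colours, and K forbids at most one colour at each vertex, so every vertex can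
    -- choose from its palette independently.
    bipartite-component : ∀ {x y} → x ∈ S → x ~ y →
      (∀ {p q} → p ∈ S → q ∈ S → p ~ x → q ~ x → p ≁ q) →
      (∀ {p q} → p ∈ S → q ∈ S → p ~ y → q ~ y → p ≁ q) →
      (∀ {w s} → w ∈ S → s ∈ S → w ~ s → s ~ x ⊎ s ~ y → w ~ x ⊎ w ~ y) → ⊥
    bipartite-component {x} {y} x∈S x~y indep-x indep-y closed = reduce U? x∈S (x∈S , inj₂ x~y) recolour
      where
      U : Pred V 0ℓ
      U w = w ∈ S × (w ~ x ⊎ w ~ y)
      U? : Decidable U
      U? w = (w ∈? S) ×-dec ((w ~? x) ⊎-dec (w ~? y))
      module _ (c : V → Fin m) (p : Proper (λ w → InK w ⊎ w ∈ S × ¬ U w) c) where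
        colour : Fin 4 → Fin m
        colour i = inject≤ i 4≤m
        colour-inj : ∀ {a b} → colour a ≡ colour b → a ≡ b
        colour-inj = inject≤-injective 4≤m 4≤m _ _
        pick : V → Fin 4 → Fin 4 → Fin 4
        pick w a b with Blocked? c w (colour a)
        ... | yes _ = b
        ... | no _ = a
        pick-⊎ : ∀ w a b → pick w a b ≡ a ⊎ pick w a b ≡ b
        pick-⊎ w a b with Blocked? c w (colour a)
        ... | yes _ = inj₂ refl
        ... | no _ = inj₁ refl
        pick-free : ∀ {w a b i} → a ≢ b → w ∈ S → w ~ v i → colour (pick w a b) ≢ c (v i)
        pick-free {w} {a} {b} a≢b w∈S w~i e with Blocked? c w (colour a)
        ... | yes (_ , ca) = a≢b (colour-inj (trans (sym ca) (trans (proj₂ (blocked c w∈S w~i)) (sym e))))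
        ... | no ¬bl = ¬bl (subst (Blocked c w) (sym e) (blocked c w∈S w~i))
        choice : V → Fin 4
        choice w with w ~? y
        ... | yes _ = pick w zero (suc zero)
        ... | no _ = pick w (suc (suc zero)) (suc (suc (suc zero)))
        choice-free : ∀ {w i} → w ∈ S → w ~ v i → colour (choice w) ≢ c (v i)
        choice-free {w} w∈S w~i with w ~? y
        ... | yes _ = pick-free (λ ()) w∈S w~i
        ... | no _ = pick-free (λ ()) w∈S w~i
        palettes : ∀ u w → pick u zero (suc zero) ≢ pick w (suc (suc zero)) (suc (suc (suc zero)))
        palettes u w e with pick u zero (suc zero) | pick-⊎ u zero (suc zero)
          | pick w (suc (suc zero)) (suc (suc (suc zero))) | pick-⊎ w (suc (suc zero)) (suc (suc (suc zero)))
        ... | _ | inj₁ refl | _ | inj₁ refl = case e of λ ()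
        ... | _ | inj₁ refl | _ | inj₂ refl = case e of λ ()
        ... | _ | inj₂ refl | _ | inj₁ refl = case e of λ ()
        ... | _ | inj₂ refl | _ | inj₂ refl = case e of λ ()
        choice-proper : ∀ {u w} → U u → U w → u ~ w → choice u ≢ choice w
        choice-proper {u} {w} (u∈S , u~) (w∈S , w~) u~w e with u ~? y | w ~? y
        ... | yes u~y | yes w~y = ~≁ u~w (indep-y u∈S w∈S u~y w~y)
        ... | yes _ | no _ = palettes u w e
        ... | no _ | yes _ = palettes w u (sym e)
        ... | no u≁y | no w≁y = ~≁ u~w (indep-x u∈S w∈S
          ([ id , (λ q → contradiction q u≁y) ]′ u~) ([ id , (λ q → contradiction q w≁y) ]′ w~))
        c′ : V → Fin m
        c′ w with U? w
        ... | yes _ = colour (choice w)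
        ... | no _ = c w
        U-rest : ∀ {u w} → U u → ¬ U w → Domain S w → u ~ w → colour (choice u) ≢ c w
        U-rest (u∈S , _) _ (inj₁ (i , refl)) u~w = choice-free u∈S u~w
        U-rest (u∈S , u~) ¬w (inj₂ w∈S) u~w _ = ¬w (w∈S , closed w∈S u∈S (~-sym u~w) u~)
        recolour : Good S
        recolour = c′ , c′-proper
          where
          rest : ∀ {w} → ¬ U w → Domain S w → InK w ⊎ w ∈ S × ¬ U w
          rest ¬w (inj₁ k) = inj₁ k
          rest ¬w (inj₂ w∈S) = inj₂ (w∈S , ¬w)
          c′-proper : Proper (Domain S) c′
          c′-proper {u} {w} du dw u~w e with U? u | U? w
          ... | yes uu | yes uw = choice-proper uu uw u~w (colour-inj e)
          ... | yes uu | no ¬w = U-rest uu ¬w dw u~w e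
          ... | no ¬u | yes uw = U-rest uw ¬u du (~-sym u~w) (sym e)
          ... | no ¬u | no ¬w = p (rest ¬u du) (rest ¬w dw) u~w e

    -- In the triangle `x`, `y`, `z`, diamond-freeness separates `p` and `q` from `z`. If `p` and
    -- `q` are nonadjacent, then `p x y q` is an induced path, which `T₁` has to cover; otherwise
    -- `p q y z` is one, and `T₂` has to cover it.
    no-two-out : ∀ {x y z p q} T₁ T₂ → length T₁ ≤ suc j → length T₂ ≤ suc j → x ~ y → z ~ x → z ~ y →
      p ~ x → p ≢ y → p ≁ y → q ~ y → q ≢ x → q ≁ x →
      TagIn T₁ p → TagIn T₁ x → TagIn T₁ y → TagIn T₁ q →
      TagIn T₂ p → TagIn T₂ q → TagIn T₂ y → TagIn T₂ z → ⊥
    no-two-out {p = p} {q} T₁ T₂ ≤₁ ≤₂ x~y z~x z~y p~x p≢y p≁y q~y q≢x q≁x p₁ x₁ y₁ q₁ p₂ q₂ y₂ z₂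
      with ~-or-≁ p q
    ... | inj₂ p≁q = noP4 T₁ ≤₁ ((p~x , x~y , ~-sym q~y) , p≁y , p≁q , ≁-sym q≁x) p₁ x₁ y₁ q₁
    ... | inj₁ p~q = noP4 T₂ ≤₂ ((p~q , q~y , ~-sym z~y) , p≁y , p≁z , q≁z) p₂ q₂ y₂ z₂
      where
      p≁z = ≁-intro λ p~z → ~≁ (diamond (~-sym z~x) p~x p~z (~-sym x~y) (~-sym z~y) p≢y) p≁y
      q≁z = ≁-intro λ q~z → ~≁ (diamond (~-sym z~y) q~y q~z x~y (~-sym z~x) q≢x) q≁x

    -- In a triangle, a neighbour of `x` that is adjacent to `z` but not to `y` would complete a
    -- diamond on the edge from `x` to `z`.
    Out-swap : ∀ {x y z} → x ~ y → z ~ x → z ~ y → Out x y → Out x z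
    Out-swap x~y z~x z~y (p , (p∈S , p~x) , p≢y , p≁y) =
      p , (p∈S , p~x) , (λ { refl → ~≁ z~y p≁y }) ,
      ≁-intro λ p~z → ~≁ (diamond (~-sym z~x) p~x p~z (~-sym x~y) (~-sym z~y) p≢y) p≁y

    -- K alone is coloured injectively, as it has at most `m` vertices.
    nonempty : (∀ {x} → x ∈ S → ⊥) → ⊥
    nonempty none = bad (c , c-proper)
      where
      c : V → Fin m
      c w with InK? w
      ... | yes (i , _) = inject≤ i k≤m
      ... | no _ = inject≤ zero k≤m
      c-proper : Proper (Domain S) c
      c-proper (inj₂ u∈S) _ _ _ = none u∈S
      c-proper (inj₁ _) (inj₂ w∈S) _ _ = none w∈S
      c-proper {u} {w} (inj₁ ku) (inj₁ kw) u~w e with InK? u | InK? w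
      ... | no ¬u | _ = ¬u ku
      ... | yes _ | no ¬w = ¬w kw
      ... | yes (i , refl) | yes (i′ , refl) = ~⇒≢ u~w (cong v (inject≤-injective k≤m k≤m i i′ e))

    -- Maximum cliques of order at least six

    module _ (3≤j : 3 ≤ j) where

      private
        -- Four vertices meet at most four classes, and K has at least two further vertices; thus
        -- `S` induces no P4 at all.
        close : ∀ {p q r s} → p ∈ S → q ∈ S → r ∈ S → s ∈ S →
          p ~ q → q ~ r → r ~ s → p ≁ r → q ≁ s → p ~ s
        close {p} {q} {r} {s} p∈ q∈ r∈ s∈ pq qr rs pr qs =
          closeP4 (tag p ∷ tag q ∷ tag r ∷ tag s ∷ []) (s≤s 3≤j) pq qr rs pr qs
            (tagIn-tag p∈ (here refl)) (tagIn-tag q∈ (there (here refl)))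
            (tagIn-tag r∈ (there (there (here refl)))) (tagIn-tag s∈ (there (there (there (here refl)))))

        two-out : ∀ {x y z} → x ∈ S → y ∈ S → z ∈ S → x ~ y → z ~ x → z ~ y → Out x y → Out y x → ⊥
        two-out {x} {y} {z} x∈ y∈ z∈ x~y z~x z~y (p , (p∈ , p~x) , p≢y , p≁y) (q , (q∈ , q~y) , q≢x , q≁x) =
          no-two-out (tag p ∷ tag x ∷ tag y ∷ tag q ∷ []) (tag p ∷ tag q ∷ tag y ∷ tag z ∷ []) (s≤s 3≤j) (s≤s 3≤j)
            x~y z~x z~y p~x p≢y p≁y q~y q≢x q≁x
            (tagIn-tag p∈ (here refl)) (tagIn-tag x∈ (there (here refl)))
            (tagIn-tag y∈ (there (there (here refl)))) (tagIn-tag q∈ (there (there (there (here refl)))))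
            (tagIn-tag p∈ (here refl)) (tagIn-tag q∈ (there (here refl)))
            (tagIn-tag y∈ (there (there (here refl)))) (tagIn-tag z∈ (there (there (there (here refl)))))

        -- By `two-out`, neither `y` nor `z` has a private neighbour with respect to `x`, hence by
        -- `Out-swap` none with respect to each other, and they form a simplicial pair.
        one-out : ∀ {x y z} → x ∈ S → y ∈ S → z ∈ S → x ~ y → z ~ x → z ~ y → Out x y → ⊥
        one-out x∈ y∈ z∈ x~y z~x z~y out =
          simplicial-pair y∈ z∈ (~-sym z~y)
            (λ o → ¬yx (Out-swap (~-sym z~y) x~y (~-sym z~x) o))
            (λ o → ¬zx (Out-swap z~y (~-sym z~x) x~y o))
          where
          ¬yx = two-out x∈ y∈ z∈ x~y z~x z~y out
          ¬zx = two-out x∈ z∈ y∈ (~-sym z~x) (~-sym x~y) (~-sym z~y) (Out-swap x~y z~x z~y out)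

        triangle-free : ∀ {x y z} → x ∈ S → y ∈ S → z ∈ S → x ~ y → z ~ x → z ≁ y
        triangle-free {x} {y} x∈ y∈ z∈ x~y z~x = ≁-intro triangle
          where
          triangle : ¬ _ ~ y
          triangle z~y with Out? x y | Out? y x
          ... | yes o | _ = one-out x∈ y∈ z∈ x~y z~x z~y o
          ... | no _ | yes o = one-out y∈ x∈ z∈ (~-sym x~y) z~y z~x o
          ... | no ¬o | no ¬o′ = simplicial-pair x∈ y∈ x~y ¬o ¬o′

      -- Since `S` induces neither triangles nor P4s, the component of any edge consists of the
      -- neighbours of its two ends.
      impossible-6≤k : ⊥
      impossible-6≤k = nonempty λ x∈ →
        let y , y∈ , y~x = has-nbr x∈
        in bipartite-component x∈ (~-sym y~x)
             (λ p∈ q∈ p~x q~x → ≁-sym (triangle-free x∈ p∈ q∈ (~-sym p~x) q~x))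
             (λ p∈ q∈ p~y q~y → ≁-sym (triangle-free y∈ p∈ q∈ (~-sym p~y) q~y))
             (λ w∈ s∈ w~s → λ
               { (inj₁ s~x) → inj₂ (close w∈ s∈ x∈ y∈ w~s s~x (~-sym y~x)
                   (triangle-free s∈ x∈ w∈ s~x w~s) (triangle-free x∈ y∈ s∈ (~-sym y~x) s~x))
               ; (inj₂ s~y) → inj₁ (close w∈ s∈ y∈ x∈ w~s s~y y~x
                   (triangle-free s∈ y∈ w∈ s~y w~s) (triangle-free y∈ x∈ s∈ y~x s~y)) })

  -- Maximum cliques of order 3, 4 and 5

  module SmallClique (k<6 : 3 + j < 6)
    (S : Subset (n G)) (outside : ∀ {w} → w ∈ S → Outside w)
    (smaller : ∀ S′ → S′ ⊂ S → ¬ ¬ Colours.Good 6 S′) (bad : ¬ Colours.Good 6 S) where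

    open Colours 6

    private
      k≤6 : 3 + j ≤ 6
      k≤6 = ℕ.<⇒≤ k<6

    open Irreducible 6 k≤6 (s≤s (s≤s (s≤s (s≤s z≤n)))) S outside smaller bad

    -- Structure of the classes

    Tagged : Pred V 0ℓ
    Tagged w = w ~ v (tag w)

    Tagged? : Decidable Tagged
    Tagged? w = w ~? v (tag w)

    ¬Tagged⇒Tagless : ∀ {w} → ¬ Tagged w → Tagless w
    ¬Tagged⇒Tagless ¬t i = ≁-intro (¬t ∘ tag-adj)

    -- Both `z` and `v i` are common neighbours of the edge from `x` to `y`, so they are adjacent.
    class-closed : ∀ {i x y z} → x ~ y → x ~ v i → y ~ v i → z ∈ S → z ~ x → z ~ y → z ~ v i
    class-closed x~y x~i y~i z∈ z~x z~y =
      diamond x~y z~x z~y (~-sym x~i) (~-sym y~i) λ e → outside z∈ (_ , e)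

    -- Both `x` and `z` are common neighbours of the edge from `y` to `v i`. Consequently each class
    -- induces a disjoint union of cliques.
    class-trans : ∀ {i x y z} → x ~ v i → y ~ v i → z ~ v i → x ~ y → z ~ y → x ≢ z → x ~ z
    class-trans x~i y~i z~i x~y z~y x≢z = diamond y~i x~y x~i z~y z~i x≢z

    Isolated : Fin (3 + j) → Pred V 0ℓ
    Isolated i d = ∀ e → e ∈ S → e ~ v i → d ≁ e

    Isolated? : ∀ i → Decidable (Isolated i)
    Isolated? i d = all? λ e → (e ∈? S) →-dec ((e ~? v i) →-dec (adj G d e Bool.≟ false))

    -- A neighbour `e` of `d` in the class would give the path `d′ u d e`. Closing it makes `d′`
    -- adjacent to `e` and, inside the class, to `d`; but then `u` would belong to the class by
    -- `class-closed`.
    two-in-class⇒isolated : ∀ {u i d d′} T → length T ≤ suc j → i ∈ˡ T → TagIn T u → u ∈ S → u ≁ v i →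
      d ∈ S → d ~ v i → d ~ u → d′ ∈ S → d′ ~ v i → d′ ~ u → d ≢ d′ → Isolated i d
    two-in-class⇒isolated {u} {i} {d} {d′} T T≤ i∈ tu u∈ u≁i d∈ d~i d~u d′∈ d′~i d′~u d≢d′ e e∈ e~i = ≁-intro λ d~e →
      let d′≁d = ≁-intro λ d′~d → ~≁ (class-closed d′~d d′~i d~i u∈ (~-sym d′~u) (~-sym d~u)) u≁i
          u≁e = ≁-intro λ u~e → ~≁ (class-closed d~e d~i e~i u∈ (~-sym d~u) u~e) u≁i
          d′~e = closeP4 T T≤ d′~u (~-sym d~u) d~e d′≁d u≁e
                   (tagIn d′∈ d′~i i∈) tu (tagIn d∈ d~i i∈) (tagIn e∈ e~i i∈)
      in ~≁ (class-trans d′~i e~i d~i d′~e d~e (d≢d′ ∘ sym)) d′≁d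

    Monochromatic : (V → Fin 6) → (Fin (3 + j) → Fin 6) → Set
    Monochromatic c γ = ∀ {i d} → d ∈ S → d ~ v i → Isolated i d → c d ≡ γ i

    -- Either `u` has at most one neighbour in the class, or all its neighbours there are isolated
    -- and share the colour `γ i`.
    one-colour : ∀ {c γ} → Monochromatic c γ → ∀ {u i} T → length T ≤ suc j → i ∈ˡ T → TagIn T u → u ∈ S → u ≁ v i →
      ∃ λ a → ∀ {w} → w ∈ S → w ~ v i → w ~ u → c w ≡ a
    one-colour {c} mono {u} {i} T T≤ i∈ tu u∈ u≁i with any? (λ d → (d ∈? S) ×-dec ((d ~? v i) ×-dec (d ~? u)))
    -- With no neighbour in the class, any colour serves.
    ... | no none = zero , λ w∈ w~i w~u → contradiction (_ , w∈ , w~i , w~u) none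
    ... | yes (d , d∈ , d~i , d~u) = c d , same
      where
      same : ∀ {w} → w ∈ S → w ~ v i → w ~ u → c w ≡ c d
      same {w} w∈ w~i w~u with w ≟ d
      ... | yes refl = refl
      ... | no w≢d = trans
        (mono w∈ w~i (two-in-class⇒isolated T T≤ i∈ tu u∈ u≁i w∈ w~i w~u d∈ d~i d~u w≢d))
        (sym (mono d∈ d~i (two-in-class⇒isolated T T≤ i∈ tu u∈ u≁i d∈ d~i d~u w∈ w~i w~u (w≢d ∘ sym))))

    -- Vertices without neighbours in the clique

    Z : Pred V 0ℓ
    Z w = w ∈ S × Tagless w

    Z? : Decidable Z
    Z? w = (w ∈? S) ×-dec all? λ i → adj G w (v i) Bool.≟ false

    -- Closing the path `r z z′ z″` makes `r` adjacent to `z″`. Then `r z″ z′ p` is an induced path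
    -- that meets at most one class, because `p` or `r` is tagless.
    Z-triangle : ∀ {z z′ z″ p} → Z z → Z z′ → Z z″ → z ~ z′ → z″ ~ z′ → z ≁ z″ →
      p ∈ S → p ~ z → p ~ z′ → p ≁ z″ →
      ∀ {r} → r ∈ S → r ~ z → r ≢ z′ → r ≁ z′ → Tagless p ⊎ Tagless r → ⊥
    Z-triangle {z} {z′} {z″} {p} (z∈ , tz) (z′∈ , tz′) (z″∈ , tz″) z~z′ z″~z′ z≁z″ p∈ p~z p~z′ p≁z″ {r} r∈ r~z r≢z′ r≁z′ tl =
      impossible tl
      where
      r~z″ = closeP4 (tag r ∷ []) (s≤s z≤n) r~z z~z′ (~-sym z″~z′) r≁z′ z≁z″
               (tagIn-tag r∈ (here refl)) (tagIn-tagless tz) (tagIn-tagless tz′) (tagIn-tagless tz″)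
      r≁p = ≁-intro λ r~p → ~≁ (diamond (~-sym p~z) r~z r~p (~-sym z~z′) (~-sym p~z′) r≢z′) r≁z′
      path : P4 r z″ z′ p
      path = (r~z″ , z″~z′ , ~-sym p~z′) , (r≁z′ , r≁p , ≁-sym p≁z″)
      impossible : Tagless p ⊎ Tagless r → ⊥
      impossible (inj₁ tp) = noP4 (tag r ∷ []) (s≤s z≤n) path
        (tagIn-tag r∈ (here refl)) (tagIn-tagless tz″) (tagIn-tagless tz′) (tagIn-tagless tp)
      impossible (inj₂ tr) = noP4 (tag p ∷ []) (s≤s z≤n) path
        (tagIn-tagless tr) (tagIn-tagless tz″) (tagIn-tagless tz′) (tagIn-tag p∈ (here refl))

    -- As `z″` does not dominate `z`, some neighbour `p` of `z` misses `z″`, and it is adjacent to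
    -- `z′`, since `p z z′ z″` would be a P4. A second neighbour `u` of `z` in Z is excluded by
    -- `Z-triangle`: it plays the part of `r` if it misses `z′`, and that of the common neighbour
    -- otherwise.
    Z-path-end : ∀ {z z′ z″} → Z z → Z z′ → Z z″ → z ~ z′ → z″ ~ z′ → z ≢ z″ → z ≁ z″ →
      ∀ {u} → Z u → u ~ z → u ≡ z′
    Z-path-end {z} {z′} {z″} Zz@(z∈ , tz) Zz′@(z′∈ , tz′) Zz″@(z″∈ , tz″) z~z′ z″~z′ z≢z″ z≁z″ {u} (u∈ , tu) u~z
      with u ≟ z′
    ... | yes e = e
    ... | no u≢z′ with any? (λ p → nbr? z p ×-dec (adj G p z″ Bool.≟ false))
    ...   | no none = ⊥-elim (comparable z∈ tz z″∈ (z≢z″ ∘ sym) λ {p} p∈ p~z →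
              [ id , (λ p≁ → contradiction (p , (p∈ , p~z) , p≁) none) ]′ (~-or-≁ p z″))
    ...   | yes (p , (p∈ , p~z) , p≁z″) with ~-or-≁ p z′ | ~-or-≁ u z′
    ...     | inj₂ p≁z′ | _ = ⊥-elim (noP4 (tag p ∷ []) (s≤s z≤n) ((p~z , z~z′ , ~-sym z″~z′) , (p≁z′ , p≁z″ , z≁z″))
              (tagIn-tag p∈ (here refl)) (tagIn-tagless tz) (tagIn-tagless tz′) (tagIn-tagless tz″))
    ...     | inj₁ p~z′ | inj₂ u≁z′ =
              ⊥-elim (Z-triangle Zz Zz′ Zz″ z~z′ z″~z′ z≁z″ p∈ p~z p~z′ p≁z″ u∈ u~z u≢z′ u≁z′ (inj₂ tu))
    ...     | inj₁ p~z′ | inj₁ u~z′ =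
              let r , (r∈ , r~z) , r≢z′ , r≁z′ = outward k<6 z∈ z~z′
                  u≁z″ = ≁-intro λ u~z″ → ~≁ (diamond u~z′ (~-sym u~z) z~z′ (~-sym u~z″) z″~z′ z≢z″) z≁z″
              in ⊥-elim (Z-triangle Zz Zz′ Zz″ z~z′ z″~z′ z≁z″ u∈ u~z u~z′ u≁z″ r∈ r~z r≢z′ r≁z′ (inj₁ tu))

    Centre : Pred V 0ℓ
    Centre z = Z z × ∃₂ λ x y → (Z x × x ~ z) × (Z y × y ~ z) × x ≢ y × x ≁ y

    Centre? : Decidable Centre
    Centre? z = Z? z ×-dec (any? λ x → any? λ y →
      (Z? x ×-dec (x ~? z)) ×-dec ((Z? y ×-dec (y ~? z)) ×-dec (¬? (x ≟ y) ×-dec (adj G x y Bool.≟ false))))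

    -- If `z` and `z′` were adjacent, some neighbour `t` of `z′` in Z would miss `z`, by
    -- diamond-freeness. Then `z` ends the induced path `z z′ t` and has `z′` as its only neighbour
    -- in Z, yet a centre has two.
    centres-nonadjacent : ∀ {z z′} → Centre z → Centre z′ → z ≁ z′
    centres-nonadjacent {z} {z′} (Zz , a , b , (Za , a~z) , (Zb , b~z) , a≢b , _)
      (Zz′ , x , y , (Zx , x~z′) , (Zy , y~z′) , x≢y , x≁y) = ≁-intro impossible
      where
      module _ (z~z′ : z ~ z′) where
        end : ∀ {t} → Z t → t ~ z′ → t ≢ z → t ≁ z → ⊥
        end Zt t~z′ t≢z t≁z = a≢b (trans (only Za a~z) (sym (only Zb b~z)))
          where
          only : ∀ {u} → Z u → u ~ z → u ≡ z′
          only = Z-path-end Zz Zz′ Zt z~z′ t~z′ (t≢z ∘ sym) (≁-sym t≁z)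
        impossible : ⊥
        impossible with x ≟ z | y ≟ z | ~-or-≁ x z | ~-or-≁ y z
        ... | yes refl | _ | _ | _ = end Zy y~z′ (x≢y ∘ sym) (≁-sym x≁y)
        ... | no _ | yes refl | _ | _ = end Zx x~z′ x≢y x≁y
        ... | no x≢z | no _ | inj₂ x≁z | _ = end Zx x~z′ x≢z x≁z
        ... | no _ | no y≢z | inj₁ _ | inj₂ y≁z = end Zy y~z′ y≢z y≁z
        ... | no _ | no _ | inj₁ x~z | inj₁ y~z = ~≁ (diamond z~z′ x~z x~z′ y~z y~z′ x≢y) x≁y

    -- Centres come first: they are pairwise nonadjacent and see at most one colour of each class.
    -- Any other vertex of Z forms a clique with its neighbours in Z, so `Z-bound` leaves it a
    -- colour even if every class shows one.
    colour-Z : ∀ {c γ} → Proper (λ w → InK w ⊎ w ∈ S × Tagged w) c → Monochromatic c γ →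
      (∀ {L} → Clique L → All Z L → length L + (3 + j) ≤ 6) → ⊥
    colour-Z {c} {γ} p mono Z-bound =
      let c₁ , agree₁ , p₁ = centres
          c₂ , _ , p₂ = others c₁ agree₁ p₁
      in bad (c₂ , λ du dw → p₂ (cover du) (cover dw))
      where
      D : Pred V 0ℓ
      D w = InK w ⊎ w ∈ S × Tagged w
      Z-untagged : ∀ {w} → Z w → ¬ D w
      Z-untagged (w∈ , _) (inj₁ k) = outside w∈ k
      Z-untagged (_ , tl) (inj₂ (_ , t)) = ~≁ t (tl _)
      Z-nbr? : ∀ u → Decidable (λ w → Z w × w ~ u)
      Z-nbr? u w = Z? w ×-dec (w ~? u)
      module _ (c′ : V → Fin 6) (agree : AgreeOn D c c′) {u : V} (Zu : Z u) where
        slots : ∀ i → ∃ λ a → ∀ {w} → w ∈ S → w ~ v i → w ~ u → c′ w ≡ a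
        slots i = one-colour {c′} {γ} (λ d∈ d~i iso → trans (agree (inj₂ (d∈ , tag-adj d~i))) (mono d∈ d~i iso))
          (i ∷ []) (s≤s z≤n) (here refl) (tagIn-tagless (proj₂ Zu)) (proj₁ Zu) (proj₂ Zu i)
        slot : Fin (3 + j) → Fin 6
        slot i = proj₁ (slots i)
        slots-length : length (map slot (allFin (3 + j))) ≡ 3 + j
        slots-length = trans (length-map slot (allFin (3 + j))) (length-tabulate {n = 3 + j} id)
        in-slot : ∀ {w} → D w → w ~ u → c′ w ∈ˡ map slot (allFin (3 + j))
        in-slot (inj₁ (i , refl)) w~u = ~≁ (~-sym w~u) (proj₂ Zu i)
        in-slot {w} (inj₂ (w∈ , tw)) w~u = subst (_∈ˡ map slot (allFin (3 + j)))
          (sym (proj₂ (slots (tag w)) w∈ tw w~u)) (∈-map⁺ slot (∈-allFin (tag w)))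
        seen-length : ¬ Centre u → length (map c′ (vertices (Z-nbr? u)) ++ map slot (allFin (3 + j))) < 6
        seen-length ¬cu = subst (_< 6)
          (sym (trans (length-++ (map c′ (vertices (Z-nbr? u)))) (cong₂ _+_ (length-map c′ (vertices (Z-nbr? u))) slots-length)))
          (Z-bound
            (All.map (λ (_ , w~u) → ~-sym w~u) (All-vertices (Z-nbr? u)) ∷ vertices-clique (Z-nbr? u) nbrs-adj)
            (Zu ∷ All.map proj₁ (All-vertices (Z-nbr? u))))
          where
          nbrs-adj : ∀ {x y} → Z x × x ~ u → Z y × y ~ u → x ≢ y → x ~ y
          nbrs-adj {x} {y} nx ny x≢y with ~-or-≁ x y
          ... | inj₁ x~y = x~y
          ... | inj₂ x≁y = contradiction (Zu , x , y , nx , ny , x≢y , x≁y) ¬cu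
      centres : ∃ λ c₁ → AgreeOn D c c₁ × Proper (λ w → D w ⊎ Centre w) c₁
      centres = greedy Centre? (λ (Zw , _) → Z-untagged Zw) p λ c′ agree {u} (Zu , cu) →
        map (slot c′ agree Zu) (allFin (3 + j)) ,
        ℕ.≤-<-trans (ℕ.≤-reflexive (slots-length c′ agree Zu)) k<6 ,
        λ { (inj₁ dw) w~u → in-slot c′ agree Zu dw w~u
          ; (inj₂ cw) w~u → ~≁ w~u (centres-nonadjacent cw (Zu , cu)) }
      others : ∀ c₁ → AgreeOn D c c₁ → Proper (λ w → D w ⊎ Centre w) c₁ →
        ∃ λ c₂ → AgreeOn (λ w → D w ⊎ Centre w) c₁ c₂ ×
          Proper (λ w → (D w ⊎ Centre w) ⊎ Z w × ¬ Centre w) c₂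
      others c₁ agree₁ p₁ = greedy (λ w → Z? w ×-dec ¬? (Centre? w))
        (λ { (Zw , _) (inj₁ dw) → Z-untagged Zw dw ; (_ , ¬cw) (inj₂ cw) → ¬cw cw }) p₁
        λ c′ agree {u} (Zu , ¬cu) →
          let agree′ : AgreeOn D c c′
              agree′ d = trans (agree (inj₁ d)) (agree₁ d)
              Z-seen : ∀ {w} → Z w → w ~ u → c′ w ∈ˡ map c′ (vertices (Z-nbr? u)) ++ map (slot c′ agree′ Zu) (allFin (3 + j))
              Z-seen Zw w~u = ∈-++⁺ˡ (∈-map⁺ c′ (∈-vertices (Z-nbr? u) (Zw , w~u)))
          in map c′ (vertices (Z-nbr? u)) ++ map (slot c′ agree′ Zu) (allFin (3 + j)) ,
             seen-length c′ agree′ Zu ¬cu ,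
             λ { (inj₁ (inj₁ dw)) w~u → ∈-++⁺ʳ (map c′ (vertices (Z-nbr? u))) (in-slot c′ agree′ Zu dw w~u)
               ; (inj₁ (inj₂ (Zw , _))) w~u → Z-seen Zw w~u
               ; (inj₂ (Zw , _)) w~u → Z-seen Zw w~u }
      cover : ∀ {w} → Domain S w → (D w ⊎ Centre w) ⊎ Z w × ¬ Centre w
      cover (inj₁ k) = inj₁ (inj₁ (inj₁ k))
      cover {w} (inj₂ w∈) with Tagged? w | Centre? w
      ... | yes t | _ = inj₁ (inj₁ (inj₂ (w∈ , t)))
      ... | no _ | yes cw = inj₁ (inj₂ cw)
      ... | no ¬t | no ¬cw = inj₂ ((w∈ , ¬Tagged⇒Tagless ¬t) , ¬cw)

    -- Of the vertices in the paths of `no-two-out`, only the private neighbours `p` and `q` can lie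
    -- in classes.
    Z-triangle-free : 1 ≤ j → ∀ {x y z} → Z x → Z y → Z z → x ~ y → z ~ x → z ~ y → ⊥
    Z-triangle-free 1≤j (x∈ , tx) (y∈ , ty) (z∈ , tz) x~y z~x z~y =
      let p , (p∈ , p~x) , p≢y , p≁y = outward k<6 x∈ x~y
          q , (q∈ , q~y) , q≢x , q≁x = outward k<6 y∈ (~-sym x~y)
          T = tag p ∷ tag q ∷ []
          tp = tagIn-tag p∈ (here refl)
          tq = tagIn-tag q∈ (there (here refl))
      in no-two-out T T (s≤s 1≤j) (s≤s 1≤j) x~y z~x z~y p~x p≢y p≁y q~y q≢x q≁x
           tp (tagIn-tagless tx) (tagIn-tagless ty) tq tp tq (tagIn-tagless ty) (tagIn-tagless tz)

    -- K is coloured by `κ`, and the isolated vertices of the class of `v i` receive `α i`, which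
    -- causes no conflict as distinct classes have distinct colours. The remaining attached vertices
    -- follow greedily by `seen`, and Z by `colour-Z`.
    colour-A : (α κ : Fin (3 + j) → Fin 6) → Injective _≡_ _≡_ α → Injective _≡_ _≡_ κ → (∀ i → κ i ≢ α i) →
      (∀ {c} → Monochromatic c α → ∀ {u} → u ∈ S → Tagged u → ¬ Isolated (tag u) u →
        ∃ λ L → length L < 6 × (∀ {w} → InK w ⊎ w ∈ S × Tagged w → w ~ u → c w ∈ˡ L)) →
      (∀ {L} → Clique L → All Z L → length L + (3 + j) ≤ 6) → ⊥
    colour-A α κ α-inj κ-inj κ≢α seen Z-bound =
      let c , agree , p = greedy J? J-new c₀-proper λ c′ agree (u∈ , tu , ¬iso) →
            let L , L<6 , L∋ = seen (mono agree) u∈ tu ¬iso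
            in L , L<6 , L∋ ∘ merge
      in colour-Z (λ du dw → p (split du) (split dw)) (mono agree) Z-bound
      where
      Core J : Pred V 0ℓ
      Core w = w ∈ S × Tagged w × Isolated (tag w) w
      J w = w ∈ S × Tagged w × ¬ Isolated (tag w) w
      J? : Decidable J
      J? w = (w ∈? S) ×-dec (Tagged? w ×-dec ¬? (Isolated? (tag w) w))
      D : Pred V 0ℓ
      D w = InK w ⊎ Core w
      J-new : ∀ {w} → J w → ¬ D w
      J-new (w∈ , _) (inj₁ k) = outside w∈ k
      J-new (_ , _ , ¬iso) (inj₂ (_ , _ , iso)) = ¬iso iso
      merge : ∀ {w} → D w ⊎ J w → InK w ⊎ w ∈ S × Tagged w
      merge (inj₁ (inj₁ k)) = inj₁ k
      merge (inj₁ (inj₂ (w∈ , tw , _))) = inj₂ (w∈ , tw)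
      merge (inj₂ (w∈ , tw , _)) = inj₂ (w∈ , tw)
      split : ∀ {w} → InK w ⊎ w ∈ S × Tagged w → D w ⊎ J w
      split (inj₁ k) = inj₁ (inj₁ k)
      split {w} (inj₂ (w∈ , tw)) with Isolated? (tag w) w
      ... | yes iso = inj₁ (inj₂ (w∈ , tw , iso))
      ... | no ¬iso = inj₂ (w∈ , tw , ¬iso)
      c₀ : V → Fin 6
      c₀ w with InK? w
      ... | yes (i , _) = κ i
      ... | no _ = α (tag w)
      c₀-K : ∀ i → c₀ (v i) ≡ κ i
      c₀-K i with InK? (v i)
      ... | yes (i′ , e) = cong κ (sym (v-inj e))
      ... | no out = contradiction (i , refl) out
      c₀-S : ∀ {w} → w ∈ S → c₀ w ≡ α (tag w)
      c₀-S {w} w∈ with InK? w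
      ... | yes k = contradiction k (outside w∈)
      ... | no _ = refl
      K-S : ∀ {i w} → w ∈ S → w ~ v i → c₀ (v i) ≢ c₀ w
      K-S {i} w∈ w~i e = κ≢α i (trans (sym (c₀-K i)) (trans e (trans (c₀-S w∈) (cong α (tag-spec (outside w∈) w~i)))))
      c₀-proper : Proper D c₀
      c₀-proper (inj₁ (i , refl)) (inj₁ (i′ , refl)) u~w e =
        ~⇒≢ u~w (cong v (κ-inj (trans (sym (c₀-K i)) (trans e (c₀-K i′)))))
      c₀-proper (inj₁ (i , refl)) (inj₂ (w∈ , _)) u~w = K-S w∈ (~-sym u~w)
      c₀-proper (inj₂ (u∈ , _)) (inj₁ (i , refl)) u~w = K-S u∈ u~w ∘ sym
      c₀-proper {u} {w} (inj₂ (u∈ , tu , iso)) (inj₂ (w∈ , tw , _)) u~w e =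
        ~≁ u~w (iso w w∈ (subst (λ i → w ~ v i) (sym (α-inj (trans (sym (c₀-S u∈)) (trans e (c₀-S w∈))))) tw))
      mono : ∀ {c} → AgreeOn D c₀ c → Monochromatic c α
      mono agree {d = d} d∈ d~i iso with tag-spec (outside d∈) d~i
      ... | refl = trans (agree (inj₂ (d∈ , d~i , iso))) (c₀-S d∈)


    α κ : Fin (3 + j) → Fin 6
    α i = inject≤ i k≤6
    κ i = α (rotate i)

    α-injective : Injective _≡_ _≡_ α
    α-injective = inject≤-injective k≤6 k≤6 _ _

    κ-injective : Injective _≡_ _≡_ κ
    κ-injective = rotate-injective ∘ α-injective

    κ≢α : ∀ i → κ i ≢ α i
    κ≢α i = rotate-≢ i ∘ α-injective

    -- Maximum cliques of order five

    module _ (2≤j : 2 ≤ j) where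

      private
        1≤j : 1 ≤ j
        1≤j = ℕ.≤-trans (s≤s z≤n) 2≤j

        -- If the edge lies in a triangle, `no-two-out` applies to private neighbours of its ends.
        -- If not, a private neighbour `a` of `z′` dominates `z`: for each neighbour `p` of `z`, the
        -- path `p z z′ a` closes.
        Z-independent : ∀ {z z′} → Z z → Z z′ → z ~ z′ → ⊥
        Z-independent {z} {z′} (z∈ , tz) (z′∈ , tz′) z~z′ with any? (λ w → nbr? z w ×-dec (w ~? z′))
        ... | yes (w , (w∈ , w~z) , w~z′) =
          let p , (p∈ , p~z) , p≢z′ , p≁z′ = outward k<6 z∈ z~z′
              q , (q∈ , q~z′) , q≢z , q≁z = outward k<6 z′∈ (~-sym z~z′)
          in no-two-out (tag p ∷ tag q ∷ []) (tag p ∷ tag q ∷ tag w ∷ []) (s≤s 1≤j) (s≤s 2≤j)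
               z~z′ w~z w~z′ p~z p≢z′ p≁z′ q~z′ q≢z q≁z
               (tagIn-tag p∈ (here refl)) (tagIn-tagless tz) (tagIn-tagless tz′) (tagIn-tag q∈ (there (here refl)))
               (tagIn-tag p∈ (here refl)) (tagIn-tag q∈ (there (here refl))) (tagIn-tagless tz′)
               (tagIn-tag w∈ (there (there (here refl))))
        ... | no none =
          let a , (a∈ , a~z′) , a≢z , a≁z = outward k<6 z′∈ (~-sym z~z′)
          in comparable z∈ tz a∈ a≢z λ {p} p∈ p~z →
               closeP4 (tag p ∷ tag a ∷ []) (s≤s 1≤j) p~z z~z′ (~-sym a~z′)
                 (≁-intro λ p~z′ → none (p , (p∈ , p~z) , p~z′)) (≁-sym a≁z)
                 (tagIn-tag p∈ (here refl)) (tagIn-tagless tz) (tagIn-tagless tz′) (tagIn-tag a∈ (there (here refl)))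

        Z-bound : ∀ {L} → Clique L → All Z L → length L + (3 + j) ≤ 6
        Z-bound [] _ = k≤6
        Z-bound ([] ∷ _) _ = k<6
        Z-bound ((x~y ∷ _) ∷ _) (Zx ∷ Zy ∷ _) = ⊥-elim (Z-independent Zx Zy x~y)

        module _ {i x y} (x∈ : x ∈ S) (x~i : x ~ v i) (y∈ : y ∈ S) (y~i : y ~ v i) (x~y : x ~ y) where

          -- The third vertex `s` lies in the same class by `class-closed`, so together with `p` and
          -- `q` at most three classes are met.
          no-triangle : ∀ {s} → s ∈ S → s ~ x → s ~ y → ⊥
          no-triangle {s} s∈ s~x s~y =
            let p , (p∈ , p~x) , p≢y , p≁y = outward k<6 x∈ x~y
                q , (q∈ , q~y) , q≢x , q≁x = outward k<6 y∈ (~-sym x~y)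
                T = i ∷ tag p ∷ tag q ∷ []
                s~i = class-closed x~y x~i y~i s∈ s~x s~y
                tp = tagIn-tag p∈ (there (here refl))
                tq = tagIn-tag q∈ (there (there (here refl)))
                ty = tagIn y∈ y~i (here refl)
            in no-two-out T T (s≤s 2≤j) (s≤s 2≤j) x~y s~x s~y p~x p≢y p≁y q~y q≢x q≁x
                 tp (tagIn x∈ x~i (here refl)) ty tq tp tq ty (tagIn s∈ s~i (here refl))

          -- A private neighbour `p` of `x` is adjacent to every neighbour `t` of `y`, since
          -- `p x y t` closes. If `s` and `s′` were adjacent, `p` and `y` would be common neighbours
          -- of that edge and hence adjacent.
          nbrs-independent : ∀ {s s′} → s ∈ S → s′ ∈ S → s ~ y → s′ ~ y → s ≁ s′
          nbrs-independent {s} {s′} s∈ s′∈ s~y s′~y = ≁-intro λ s~s′ →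
            let p , (p∈ , p~x) , p≢y , p≁y = outward k<6 x∈ x~y
                joined : ∀ {t} → t ∈ S → t ~ y → p ~ t
                joined {t} t∈ t~y = closeP4 (i ∷ tag p ∷ tag t ∷ []) (s≤s 2≤j) p~x x~y (~-sym t~y) p≁y
                  (≁-sym (≁-intro λ t~x → no-triangle t∈ t~x t~y))
                  (tagIn-tag p∈ (there (here refl))) (tagIn x∈ x~i (here refl))
                  (tagIn y∈ y~i (here refl)) (tagIn-tag t∈ (there (there (here refl))))
            in ~≁ (diamond s~s′ (joined s∈ s~y) (joined s′∈ s′~y) (~-sym s~y) (~-sym s′~y) p≢y) p≁y

          nbrs-closed : ∀ {w s} → w ∈ S → s ∈ S → w ~ s → s ~ x → w ~ x ⊎ w ~ y
          nbrs-closed {w} {s} w∈ s∈ w~s s~x with ~-or-≁ w x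
          ... | inj₁ w~x = inj₁ w~x
          ... | inj₂ w≁x = inj₂ (closeP4 (i ∷ tag w ∷ tag s ∷ []) (s≤s 2≤j) w~s s~x x~y w≁x
            (≁-intro λ s~y → no-triangle s∈ s~x s~y)
            (tagIn-tag w∈ (there (here refl))) (tagIn-tag s∈ (there (there (here refl))))
            (tagIn x∈ x~i (here refl)) (tagIn y∈ y~i (here refl)))

        class-independent : ∀ {i x y} → x ∈ S → x ~ v i → y ∈ S → y ~ v i → x ≁ y
        class-independent x∈ x~i y∈ y~i = ≁-intro λ x~y →
          bipartite-component x∈ x~y
            (λ p∈ q∈ → nbrs-independent y∈ y~i x∈ x~i (~-sym x~y) p∈ q∈)
            (λ p∈ q∈ → nbrs-independent x∈ x~i y∈ y~i x~y p∈ q∈)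
            (λ w∈ s∈ w~s → λ
              { (inj₁ s~x) → nbrs-closed x∈ x~i y∈ y~i x~y w∈ s∈ w~s s~x
              ; (inj₂ s~y) → swap (nbrs-closed y∈ y~i x∈ x~i (~-sym x~y) w∈ s∈ w~s s~y) })

      -- In an independent class every vertex is isolated, so the greedy step of `colour-A` has
      -- nothing to colour.
      impossible-k≡5 : ⊥
      impossible-k≡5 = colour-A α κ α-injective κ-injective κ≢α
        (λ _ u∈ tu ¬iso → contradiction (λ e e∈ e~i → class-independent u∈ tu e∈ e~i) ¬iso) Z-bound

    -- Maximum cliques of order four

    module _ (1≤j : 1 ≤ j) (j≤1 : j ≤ 1) where

      private
        Z-bound : ∀ {L} → Clique L → All Z L → length L + (3 + j) ≤ 6
        Z-bound [] _ = k≤6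
        Z-bound ([] ∷ _) _ = k<6
        Z-bound ((_ ∷ []) ∷ _ ∷ []) _ = ℕ.+-monoʳ-≤ 5 j≤1
        Z-bound ((x~y ∷ x~z ∷ _) ∷ (y~z ∷ _) ∷ _) (Zx ∷ Zy ∷ Zz ∷ _) =
          ⊥-elim (Z-triangle-free 1≤j Zx Zy Zz x~y (~-sym x~z) (~-sym y~z))

        list-length : ∀ a (f : Fin (3 + j) → Fin 6) → length (a ∷ map f (allFin (3 + j))) < 6
        list-length a f = subst (λ l → suc l < 6)
          (sym (trans (length-map f (allFin (3 + j))) (length-tabulate {n = 3 + j} id))) (ℕ.+-monoʳ-≤ 5 j≤1)

        in-list : ∀ {x a} (f : Fin (3 + j) → Fin 6) l → x ≡ f l → x ∈ˡ a ∷ map f (allFin (3 + j))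
        in-list f l e = there (subst (_∈ˡ map f (allFin (3 + j))) (sym e) (∈-map⁺ f (∈-allFin l)))

        module _ (c : V → Fin 6) {u : V} (u∈ : u ∈ S) (i : Fin (3 + j)) (u~i : u ~ v i) where

          Class-nbr : Pred V 0ℓ
          Class-nbr b = b ∈ S × b ~ v i × b ~ u

          Class-nbr? : Decidable Class-nbr
          Class-nbr? b = (b ∈? S) ×-dec ((b ~? v i) ×-dec (b ~? u))

          -- Neighbours of `u` in its own class are left out, so the slot of `i` serves `v i` only.
          -- Beyond the four slots, one further colour may be seen.
          Slots : (Fin (3 + j) → Fin 6) → Set
          Slots slot = c (v i) ≡ slot i × (∀ {l w} → l ≢ i → w ∈ S → w ~ v l → w ~ u → c w ≡ slot l)

          SeenList : Set
          SeenList = ∃ λ L → length L < 6 × (∀ {w} → InK w ⊎ w ∈ S × Tagged w → w ~ u → c w ∈ˡ L)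

          seen-by : ∀ a slot → c (v i) ≡ slot i → (∀ {l w} → l ≢ i → w ∈ S → w ~ v l → w ~ u → c w ≡ slot l) →
            (∀ {w} → Class-nbr w → c w ∈ˡ a ∷ map slot (allFin (3 + j))) → SeenList
          seen-by a slot slot-i slot-other class = a ∷ map slot (allFin (3 + j)) , list-length a slot , covered
            where
            covered : ∀ {w} → InK w ⊎ w ∈ S × Tagged w → w ~ u → c w ∈ˡ a ∷ map slot (allFin (3 + j))
            covered (inj₁ (l , refl)) vl~u = in-list slot i
              (trans (cong (c ∘ v) (tag-unique (outside u∈) (~-sym vl~u) u~i)) slot-i)
            covered {w} (inj₂ (w∈ , tw)) w~u with w ~? v i
            ... | yes w~i = class (w∈ , w~i , w~u)
            ... | no w≁i = in-list slot (tag w) (slot-other (λ t≡i → w≁i (subst (λ l → w ~ v l) t≡i tw)) w∈ tw w~u)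

          slots : Monochromatic c α → ∃ Slots
          slots mono = proj₁ ∘ choose , proj₁ (proj₂ (choose i)) refl , λ {l} → proj₂ (proj₂ (choose l))
            where
            choose : ∀ l → ∃ λ a → (l ≡ i → c (v i) ≡ a) × (∀ {w} → l ≢ i → w ∈ S → w ~ v l → w ~ u → c w ≡ a)
            choose l with l ≟ i
            ... | yes l≡i = c (v i) , (λ _ → refl) , λ l≢i → contradiction l≡i l≢i
            ... | no l≢i =
              let a , same = one-colour {c} {α} mono (i ∷ l ∷ []) (s≤s 1≤j) (there (here refl))
                    (tagIn u∈ u~i (here refl)) u∈ (≁-intro λ u~l → l≢i (tag-unique (outside u∈) u~l u~i))
              in a , (λ l≡i → contradiction l≡i l≢i) , λ _ → same

          one-nbr : ∀ slot → Slots slot → ∀ b → (∀ {e} → Class-nbr e → e ≡ b) → SeenList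
          one-nbr slot (slot-i , slot-other) b only = seen-by (c b) slot slot-i slot-other λ n → here (cong c (only n))

          -- A class without neighbours of u: its slot is free for the colour of b.
          free-class : ∀ {b e} → Class-nbr b → Class-nbr e → e ≢ b →
            ∃ λ l₀ → l₀ ≢ i × (∀ {p} → p ∈ S → p ~ v l₀ → p ~ u → ⊥)
          free-class {b} {e} (b∈ , b~i , b~u) (e∈ , e~i , e~u) e≢b with outward k<6 b∈ b~u
          ... | q , (q∈ , q~b) , q≢u , q≁u =
            let l₀ , l₀≢i , tq = q-class (Tagged? q) in l₀ , l₀≢i , free l₀≢i tq
            where
            u~b : u ~ b
            u~b = ~-sym b~u
            e~b : e ~ b
            e~b = class-trans e~i u~i b~i e~u b~u e≢b
            -- The vertex `q` is not in the class of `v i`, as `class-trans` would make it adjacent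
            -- to `u`. If it lies in no class, any index other than `i` will do.
            q-class : Dec (Tagged q) → ∃ λ l → l ≢ i × TagIn (i ∷ l ∷ []) q
            q-class (yes tq) = tag q , (λ t≡i → ~≁ (class-trans (subst (λ l → q ~ v l) t≡i tq) b~i u~i q~b u~b q≢u) q≁u) ,
              tagIn-tag q∈ (there (here refl))
            q-class (no ¬tq) =
              let l , l∉ = fresh (i ∷ []) (s≤s (s≤s z≤n))
              in l , (λ l≡i → l∉ (here l≡i)) , tagIn-tagless (¬Tagged⇒Tagless ¬tq)
            free : ∀ {l₀} → l₀ ≢ i → TagIn (i ∷ l₀ ∷ []) q → ∀ {p} → p ∈ S → p ~ v l₀ → p ~ u → ⊥
            free {l₀} l₀≢i tq {p} p∈ p~l₀ p~u =
              -- In the triangle `u`, `b`, `e`, the vertex `p` would be private to `u` and `q` to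
              -- `b`, while only the classes of `i` and `l₀` are met.
              no-two-out (i ∷ l₀ ∷ []) (i ∷ l₀ ∷ []) (s≤s 1≤j) (s≤s 1≤j) u~b e~u e~b p~u p≢b p≁b q~b q≢u q≁u
                (tagIn p∈ p~l₀ (there (here refl))) (tagIn u∈ u~i (here refl)) (tagIn b∈ b~i (here refl)) tq
                (tagIn p∈ p~l₀ (there (here refl))) tq (tagIn b∈ b~i (here refl)) (tagIn e∈ e~i (here refl))
              where
              p≁b : p ≁ b
              p≁b = ≁-intro λ p~b → l₀≢i (tag-unique (outside p∈) p~l₀ (class-closed u~b u~i b~i p∈ p~u p~b))
              p≢b : p ≢ b
              p≢b refl = l₀≢i (tag-unique (outside p∈) p~l₀ b~i)

          -- The three neighbours, `u` and `v i` would form a clique of order five.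
          third-nbr : ∀ {b e w} → Class-nbr b → Class-nbr e → Class-nbr w → e ≢ b → w ≢ b → w ≢ e → ⊥
          third-nbr {b} {e} {w} (_ , b~i , b~u) (_ , e~i , e~u) (_ , w~i , w~u) e≢b w≢b w≢e =
            ℕ.<⇒≱ (ℕ.+-monoʳ-≤ 4 j≤1) (clique-bound clique)
            where
            clique : Clique (w ∷ e ∷ b ∷ u ∷ v i ∷ [])
            clique =
              (class-trans w~i u~i e~i w~u e~u w≢e ∷ class-trans w~i u~i b~i w~u b~u w≢b ∷ w~u ∷ w~i ∷ []) ∷
              (class-trans e~i u~i b~i e~u b~u e≢b ∷ e~u ∷ e~i ∷ []) ∷ (b~u ∷ b~i ∷ []) ∷ (u~i ∷ []) ∷ [] ∷ []

          -- The vacant slot `l₀` is overwritten with the colour of `b`, and the colour of `e` takes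
          -- the extra place.
          two-nbrs : ∀ slot → Slots slot → ∀ {b e} → Class-nbr b → Class-nbr e → e ≢ b →
            (∃ λ l₀ → l₀ ≢ i × (∀ {p} → p ∈ S → p ~ v l₀ → p ~ u → ⊥)) → SeenList
          two-nbrs slot (slot-i , slot-other) {b} {e} nb ne e≢b (l₀ , l₀≢i , free) =
            seen-by (c e) slot′ (trans slot-i (slot′-other (l₀≢i ∘ sym)))
              (λ {l} {w} l≢i w∈ w~l w~u → trans (slot-other l≢i w∈ w~l w~u)
                (slot′-other λ l≡l₀ → free w∈ (subst (λ l → w ~ v l) l≡l₀ w~l) w~u))
              class
            where
            slot′ : Fin (3 + j) → Fin 6
            slot′ l with l ≟ l₀
            ... | yes _ = c b
            ... | no _ = slot l
            slot′-l₀ : c b ≡ slot′ l₀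
            slot′-l₀ with l₀ ≟ l₀
            ... | yes _ = refl
            ... | no ≢ = contradiction refl ≢
            slot′-other : ∀ {l} → l ≢ l₀ → slot l ≡ slot′ l
            slot′-other {l} l≢ with l ≟ l₀
            ... | yes l≡ = contradiction l≡ l≢
            ... | no _ = refl
            class : ∀ {w} → Class-nbr w → c w ∈ˡ c e ∷ map slot′ (allFin (3 + j))
            class {w} nw with w ≟ b | w ≟ e
            ... | yes w≡b | _ = in-list slot′ l₀ (trans (cong c w≡b) slot′-l₀)
            ... | no _ | yes w≡e = here (cong c w≡e)
            ... | no w≢b | no w≢e = ⊥-elim (third-nbr nb ne nw e≢b w≢b w≢e)

          seen : Monochromatic c α → ¬ Isolated i u → SeenList
          seen mono ¬iso = cases (any? Class-nbr?)
            where
            slot = slots mono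
            further : ∀ {b} → Class-nbr b → Dec (∃ λ e → Class-nbr e × e ≢ b) → SeenList
            further nb (yes (e , ne , e≢b)) = two-nbrs (proj₁ slot) (proj₂ slot) nb ne e≢b (free-class nb ne e≢b)
            further {b} nb (no none) = one-nbr (proj₁ slot) (proj₂ slot) b
              λ {e} ne → decidable-stable (e ≟ b) λ e≢b → none (e , ne , e≢b)
            cases : Dec (∃ Class-nbr) → SeenList
            cases (no none) = contradiction (λ e e∈ e~i → ≁-intro λ u~e → none (e , e∈ , e~i , ~-sym u~e)) ¬iso
            cases (yes (b , nb)) = further nb (any? λ e → Class-nbr? e ×-dec ¬? (e ≟ b))

      impossible-k≡4 : ⊥
      impossible-k≡4 = colour-A α κ α-injective κ-injective κ≢α
        (λ {c} mono u∈ tu → seen c u∈ _ tu mono) Z-bound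

    -- Maximum cliques of order three

    module _ (j≤0 : j ≤ 0) where

      private
        colour : Fin (3 + j) → Fin 2 → Fin 6
        colour i s = inject≤ (combine i s) (ℕ.*-monoˡ-≤ 2 (ℕ.+-monoʳ-≤ 3 j≤0))

        colour-injective : ∀ {i s i′ s′} → colour i s ≡ colour i′ s′ → i ≡ i′ × s ≡ s′
        colour-injective e = combine-injective _ _ _ _ (inject≤-injective _ _ _ _ e)

        -- Here the edges inside a class form a matching. Of the two colours of the class, the
        -- second goes to the end of each edge with the larger index.
        Later : Pred V 0ℓ
        Later w = ∃ λ e → (e ∈ S × e ~ v (tag w) × e ~ w) × toℕ e < toℕ w

        Later? : Decidable Later
        Later? w = any? λ e → ((e ∈? S) ×-dec ((e ~? v (tag w)) ×-dec (e ~? w))) ×-dec (toℕ e ℕ.<? toℕ w)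

        side : V → Fin 2
        side w with Later? w
        ... | yes _ = suc zero
        ... | no _ = zero

        c : V → Fin 6
        c w with InK? w
        ... | yes (i , _) = colour (rotate i) zero
        ... | no _ = colour (tag w) (side w)

        c-K : ∀ i → c (v i) ≡ colour (rotate i) zero
        c-K i with InK? (v i)
        ... | yes (i′ , e) = cong (λ l → colour (rotate l) zero) (sym (v-inj e))
        ... | no out = contradiction (i , refl) out

        c-S : ∀ {w} → w ∈ S → c w ≡ colour (tag w) (side w)
        c-S {w} w∈ with InK? w
        ... | yes k = contradiction k (outside w∈)
        ... | no _ = refl

        K-S : ∀ {i w} → w ∈ S → w ~ v i → c (v i) ≢ c w
        K-S {i} w∈ w~i e = rotate-≢ i
          (trans (proj₁ (colour-injective (trans (sym (c-K i)) (trans e (c-S w∈))))) (tag-spec (outside w∈) w~i))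

        -- Adjacent `u` and `w` are each other's only neighbour in the class, since a third vertex
        -- would give a clique of order four with `v i`. So exactly one of them is `Later`.
        same-class : ∀ {u w i} → u ∈ S → w ∈ S → u ~ v i → w ~ v i → u ~ w → side u ≢ side w
        same-class {u} {w} {i} u∈ w∈ u~i w~i u~w e with Later? u | Later? w
        ... | yes _ | no _ = case e of λ ()
        ... | no _ | yes _ = case e of λ ()
        ... | no ¬lu | no ¬lw with ℕ.<-cmp (toℕ u) (toℕ w)
        ...   | tri< u<w _ _ = ¬lw (u , (u∈ , subst (λ l → u ~ v l) (sym (tag-spec (outside w∈) w~i)) u~i , u~w) , u<w)
        ...   | tri> _ _ w<u = ¬lu (w , (w∈ , subst (λ l → w ~ v l) (sym (tag-spec (outside u∈) u~i)) w~i , ~-sym u~w) , w<u)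
        ...   | tri≈ _ u≡w _ = ~⇒≢ u~w (toℕ-injective u≡w)
        same-class {u} {w} {i} u∈ w∈ u~i w~i u~w e
            | yes (a , (a∈ , a~u-tag , a~u) , a<u) | yes (b , (b∈ , b~w-tag , b~w) , b<w) =
          ℕ.<-asym
            (subst (λ x → toℕ x < toℕ u)
              (partner u~i w~i u~w (subst (λ l → a ~ v l) (tag-spec (outside u∈) u~i) a~u-tag) a~u) a<u)
            (subst (λ x → toℕ x < toℕ w)
              (partner w~i u~i (~-sym u~w) (subst (λ l → b ~ v l) (tag-spec (outside w∈) w~i) b~w-tag) b~w) b<w)
          where
          partner : ∀ {x y a} → x ~ v i → y ~ v i → x ~ y → a ~ v i → a ~ x → a ≡ y
          partner {x} {y} {a} x~i y~i x~y a~i a~x with a ≟ y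
          ... | yes a≡y = a≡y
          ... | no a≢y = contradiction
            (clique-bound {a ∷ y ∷ x ∷ v i ∷ []}
              ((class-trans a~i x~i y~i a~x (~-sym x~y) a≢y ∷ a~x ∷ a~i ∷ []) ∷
               (~-sym x~y ∷ y~i ∷ []) ∷ (x~i ∷ []) ∷ [] ∷ []))
            (ℕ.<⇒≱ (ℕ.+-monoʳ-≤ 4 j≤0))

        c-proper : Proper (λ w → InK w ⊎ w ∈ S × Tagged w) c
        c-proper (inj₁ (i , refl)) (inj₁ (i′ , refl)) u~w e = ~⇒≢ u~w
          (cong v (rotate-injective (proj₁ (colour-injective (trans (sym (c-K i)) (trans e (c-K i′)))))))
        c-proper (inj₁ (i , refl)) (inj₂ (w∈ , _)) u~w = K-S w∈ (~-sym u~w)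
        c-proper (inj₂ (u∈ , _)) (inj₁ (i , refl)) u~w = K-S u∈ u~w ∘ sym
        c-proper {u} {w} (inj₂ (u∈ , tu)) (inj₂ (w∈ , tw)) u~w e =
          let t≡ , s≡ = colour-injective (trans (sym (c-S u∈)) (trans e (c-S w∈)))
          in same-class u∈ w∈ tu (subst (λ l → w ~ v l) (sym t≡) tw) u~w s≡

        mono : Monochromatic c (λ i → colour i zero)
        mono {i} {d} d∈ d~i iso with tag-spec (outside d∈) d~i | Later? d in eq
        ... | refl | yes (e , (e∈ , e~i , e~d) , _) = ~≁ (~-sym e~d) (iso e e∈ e~i)
        ... | refl | no ¬l = trans (c-S d∈) (cong (colour (tag d)) (side-zero ¬l))
          where
          side-zero : ¬ Later d → side d ≡ zero
          side-zero ¬l with Later? d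
          ... | yes l = contradiction l ¬l
          ... | no _ = refl

      impossible-k≡3 : ⊥
      impossible-k≡3 = colour-Z c-proper mono λ {L} cl _ →
        -- Cliques of Z have at most three vertices, and the classes show at most three colours.
        ℕ.≤-trans (ℕ.+-mono-≤ (clique-bound cl) (ℕ.+-monoʳ-≤ 3 j≤0)) (ℕ.+-monoˡ-≤ 3 (ℕ.+-monoʳ-≤ 3 j≤0))

  -- Induction on subsets and the upper bound

  Outside? : Decidable Outside
  Outside? w = ¬? (InK? w)

  -- Well-founded induction on subsets gives goodness only under a double negation, which
  -- decidability of colourability removes at the end.
  colourable : ∀ m →
    (∀ S → (∀ {w} → w ∈ S → Outside w) → (∀ S′ → S′ ⊂ S → ¬ ¬ Colours.Good m S′) → ¬ ¬ Colours.Good m S) →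
    Colourable G m
  colourable m irreducible-good = decidable-stable (Colourable? G m) λ none →
    good (⊂-wellFounded (subset Outside?)) (∈-subset⁻ Outside?)
      λ (c , p) → none (c , λ u w → p (cover u) (cover w))
    where
    open Colours m
    good : ∀ {S} → Acc _⊂_ S → (∀ {w} → w ∈ S → Outside w) → ¬ ¬ Good S
    good (acc rs) outside = irreducible-good _ outside
      λ S′ S′⊂S → good (rs S′⊂S) λ w∈ → outside (proj₁ S′⊂S w∈)
    cover : ∀ w → Domain (subset Outside?) w
    cover w with InK? w
    ... | yes k = inj₁ k
    ... | no out = inj₂ (∈-subset⁺ Outside? out)

6⊔ω-colourable : (G : Graph) (ω : ℕ) → Free G P2+P4 → Free G K4-e → CliqueNumber G ω → 3 ≤ ω → Colourable G (6 ⊔ ω)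
6⊔ω-colourable G (suc (suc (suc j))) no-P2+P4 no-K4-e ((v , v-inj , v-adj) , maximum) (s≤s (s≤s (s≤s z≤n))) =
  bound j v v-inj v-adj maximum
  where
  open Adjacency G
  open MaximumClique G (diamond-free no-K4-e) (p2+p4-free no-P2+P4)
  bound : ∀ j (v : Fin (3 + j) → V) → Injective _≡_ _≡_ v → (∀ i i′ → i ≢ i′ → v i ~ v i′) →
    ¬ HasClique G (4 + j) → Colourable G (6 ⊔ (3 + j))
  -- The number `6 ⊔ (3 + j)` evaluates to 6 in the first three clauses and to `6 + i` in the last.
  bound 0 v v-inj v-adj maximum = colourable 0 v v-inj v-adj maximum 6 λ S outside smaller bad →
    SmallClique.impossible-k≡3 0 v v-inj v-adj maximum (ℕ.m≤m+n 4 2) S outside smaller bad z≤n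
  bound 1 v v-inj v-adj maximum = colourable 1 v v-inj v-adj maximum 6 λ S outside smaller bad →
    SmallClique.impossible-k≡4 1 v v-inj v-adj maximum (ℕ.m≤m+n 5 1) S outside smaller bad ℕ.≤-refl ℕ.≤-refl
  bound 2 v v-inj v-adj maximum = colourable 2 v v-inj v-adj maximum 6 λ S outside smaller bad →
    SmallClique.impossible-k≡5 2 v v-inj v-adj maximum ℕ.≤-refl S outside smaller bad ℕ.≤-refl
  bound (suc (suc (suc i))) v v-inj v-adj maximum =
    colourable (3 + i) v v-inj v-adj maximum (6 + i) λ S outside smaller bad →
      Irreducible.impossible-6≤k (3 + i) v v-inj v-adj maximum (6 + i) ℕ.≤-refl (ℕ.m≤m+n 4 (2 + i))
        S outside smaller bad (ℕ.m≤m+n 3 i)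

-- The 27 lines on a cubic surface

module Refutation {V : Set} (adj : V → V → Bool) where

  -- A vertex, with a flag for each open colour class telling whether the vertex may still join it.
  Candidate : Set
  Candidate = V × List Bool

  count : List Bool → ℕ
  count [] = 0
  count (true ∷ bs) = suc (count bs)
  count (false ∷ bs) = count bs

  defer : Candidate → Candidate × List Candidate → Candidate × List Candidate
  defer y (x , xs) = x , y ∷ xs

  -- Chooses a candidate with the fewest classes left to join, which keeps the search tree small.
  select : Candidate → List Candidate → Candidate × List Candidate
  select x [] = x , []
  select x (y ∷ ys) =
    if count (proj₂ y) <ᵇ count (proj₂ x) then defer x (select y ys) else defer y (select x ys)

  strike : ℕ → List Bool → List Bool
  strike _ [] = []
  strike zero (_ ∷ bs) = false ∷ bs
  strike (suc p) (t ∷ bs) = t ∷ strike p bs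

  join : ℕ → V → List Candidate → List Candidate
  join p v = map λ (u , bs) → u , (if adj v u then strike p bs else bs)

  open-class : V → List Candidate → List Candidate
  open-class v = map λ (u , bs) → u , not (adj v u) ∷ bs

  -- Exhaustive search: the selected vertex joins an open class or opens one of the r remaining
  -- classes, so that the colours need not be named. The first argument bounds the depth.
  refute : ℕ → ℕ → List Candidate → Bool
  branch : ℕ → ℕ → Candidate × List Candidate → Bool
  opens : ℕ → ℕ → V → List Candidate → Bool
  joins : ℕ → ℕ → V → List Candidate → ℕ → List Bool → Bool

  refute zero _ _ = false
  refute (suc f) r [] = false
  refute (suc f) r (x ∷ xs) = branch f r (select x xs)

  branch f r ((v , bs) , rest) = opens f r v rest ∧ joins f r v rest 0 bs

  opens f zero v rest = true
  opens f (suc r) v rest = refute f r (open-class v rest)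

  joins f r v rest p [] = true
  joins f r v rest p (true ∷ bs) = refute f r (join p v rest) ∧ joins f r v rest (suc p) bs
  joins f r v rest p (false ∷ bs) = joins f r v rest (suc p) bs

  module _ {t} (col : V → Fin t) (proper : ∀ u w → adj u w ≡ true → col u ≢ col w) where

    -- Here `σ` lists the colours of the open classes, the latest first. A true flag claims nothing.
    Consistent : List (Fin t) → Candidate → Set
    Consistent σ (u , bs) = Pointwise (λ flag s → flag ≡ false → col u ≢ s) bs σ

    Nth : ℕ → Fin t → List (Fin t) → Set
    Nth _ s [] = ⊥
    Nth zero s (x ∷ _) = x ≡ s
    Nth (suc p) s (_ ∷ σ) = Nth p s σ

    select-All : ∀ {P : Candidate → Set} x xs → P x → All P xs → P (proj₁ (select x xs)) × All P (proj₂ (select x xs))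
    select-All x [] px [] = px , []
    select-All x (y ∷ ys) px (py ∷ pys) with count (proj₂ y) <ᵇ count (proj₂ x)
    ... | true = let pz , pzs = select-All y ys py pys in pz , px ∷ pzs
    ... | false = let pz , pzs = select-All x ys px pys in pz , py ∷ pzs

    strike-consistent : ∀ {u s σ} p bs → col u ≢ s → Nth p s σ → Consistent σ (u , bs) → Consistent σ (u , strike p bs)
    strike-consistent zero (_ ∷ bs) ≢s refl (_ ∷ cs) = (λ _ → ≢s) ∷ cs
    strike-consistent (suc p) (_ ∷ bs) ≢s nth (k ∷ cs) = k ∷ strike-consistent p bs ≢s nth cs

    join-consistent : ∀ {v p σ} xs → Nth p (col v) σ → All (Consistent σ) xs → All (Consistent σ) (join p v xs)
    join-consistent [] nth [] = []
    join-consistent {v} {p} {σ} ((u , bs) ∷ xs) nth (k ∷ ks) = head ∷ join-consistent xs nth ks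
      where
      head : Consistent σ (u , (if adj v u then strike p bs else bs))
      head with adj v u in eq
      ... | true = strike-consistent p bs (proper v u eq ∘ sym) nth k
      ... | false = k

    open-consistent : ∀ {v σ} xs → All (Consistent σ) xs → All (Consistent (col v ∷ σ)) (open-class v xs)
    open-consistent [] [] = []
    open-consistent {v} ((u , _) ∷ xs) (k ∷ ks) =
      ((λ eq → proper v u (Bool.not-injective eq) ∘ sym) ∷ k) ∷ open-consistent xs ks

    -- The colouring `col` points to one branch at each vertex: join a class if its colour occurs in
    -- `σ`, open one otherwise. By `t ≤ r + length σ`, a new colour always finds a class left to
    -- open.
    refute-sound : ∀ f {r σ} xs → refute f r xs ≡ true → All (Consistent σ) xs → Unique σ → t ≤ r + length σ → ⊥
    opens-sound : ∀ f {r σ} v rest → opens f r v rest ≡ true → All (Consistent σ) rest → Unique (col v ∷ σ) →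
      t ≤ r + length σ → ⊥
    -- The list `τ` holds the open colours still to be scanned, and `embed` records that it starts
    -- at position `p` of `σ`.
    joins-sound : ∀ f {r σ τ} v rest p bs → joins f r v rest p bs ≡ true → Consistent τ (v , bs) →
      (∀ {q s} → Nth q s τ → Nth (q + p) s σ) → col v ∈ˡ τ →
      All (Consistent σ) rest → Unique σ → t ≤ r + length σ → ⊥

    refute-sound (suc f) {r} {σ} (x ∷ xs) eq (k ∷ ks) uniq t≤ with select x xs | select-All x xs k ks
    ... | (v , bs) , rest | kv , krest with DecMem._∈?_ _≟_ (col v) σ
    ...   | yes v∈ = joins-sound f v rest 0 bs (Bool.∧-conicalʳ _ _ eq) kv
      (λ {q} {s} → subst (λ l → Nth l s σ) (sym (ℕ.+-identityʳ q))) v∈ krest uniq t≤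
    ...   | no v∉ = opens-sound f v rest (Bool.∧-conicalˡ _ _ eq) krest
      (All.tabulate (λ s∈ e → v∉ (subst (_∈ˡ σ) (sym e) s∈)) ∷ uniq) t≤

    opens-sound f {zero} v rest eq krest uniq t≤ = ℕ.<⇒≱ (s≤s t≤) (Unique-length uniq)
    opens-sound f {suc r} {σ} v rest eq krest uniq t≤ =
      refute-sound f (open-class v rest) eq (open-consistent rest krest) uniq (subst (t ≤_) (sym (ℕ.+-suc r (length σ))) t≤)

    joins-sound f v rest p (true ∷ bs) eq (_ ∷ ks) embed (here refl) krest uniq t≤ =
      refute-sound f (join p v rest) (Bool.∧-conicalˡ _ _ eq) (join-consistent rest (embed {0} refl) krest) uniq t≤
    joins-sound f v rest p (false ∷ bs) eq (k ∷ ks) embed (here refl) krest uniq t≤ = k refl refl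
    joins-sound f {σ = σ} v rest p (true ∷ bs) eq (_ ∷ ks) embed (there v∈) krest uniq t≤ =
      joins-sound f v rest (suc p) bs (Bool.∧-conicalʳ _ _ eq) ks
        (λ {q} {s} nth → subst (λ l → Nth l s σ) (sym (ℕ.+-suc q p)) (embed {suc q} nth)) v∈ krest uniq t≤
    joins-sound f {σ = σ} v rest p (false ∷ bs) eq (_ ∷ ks) embed (there v∈) krest uniq t≤ =
      joins-sound f v rest (suc p) bs eq ks
        (λ {q} {s} nth → subst (λ l → Nth l s σ) (sym (ℕ.+-suc q p)) (embed {suc q} nth)) v∈ krest uniq t≤

-- Schläfli's notation for the 27 lines: a₁, …, a₆ and b₁, …, b₆ form a double-six, and c_ij is the
-- third line in the plane of a_i and b_j.
data Line : Set where
  a b : ℕ → Line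
  c : ℕ → ℕ → Line

meet : Line → Line → Bool
meet (a i) (b j) = not (i ≡ᵇ j)
meet (b i) (a j) = not (i ≡ᵇ j)
meet (a i) (c j k) = (i ≡ᵇ j) ∨ (i ≡ᵇ k)
meet (c j k) (a i) = (i ≡ᵇ j) ∨ (i ≡ᵇ k)
meet (b i) (c j k) = (i ≡ᵇ j) ∨ (i ≡ᵇ k)
meet (c j k) (b i) = (i ≡ᵇ j) ∨ (i ≡ᵇ k)
meet (c i j) (c k l) = not ((i ≡ᵇ k) ∨ (i ≡ᵇ l) ∨ (j ≡ᵇ k) ∨ (j ≡ᵇ l))
meet (a _) (a _) = false
meet (b _) (b _) = false

lines : Vec Line 27
lines =
  a 1 ∷ a 2 ∷ a 3 ∷ a 4 ∷ a 5 ∷ a 6 ∷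
  b 1 ∷ b 2 ∷ b 3 ∷ b 4 ∷ b 5 ∷ b 6 ∷
  c 1 2 ∷ c 1 3 ∷ c 1 4 ∷ c 1 5 ∷ c 1 6 ∷
  c 2 3 ∷ c 2 4 ∷ c 2 5 ∷ c 2 6 ∷
  c 3 4 ∷ c 3 5 ∷ c 3 6 ∷ c 4 5 ∷ c 4 6 ∷ c 5 6 ∷ []

lineAdj : Fin 27 → Fin 27 → Bool
lineAdj u w = meet (Vec.lookup lines u) (Vec.lookup lines w)

Lines : Graph
Lines = record
  { n = 27
  ; adj = lineAdj
  ; adj-sym = from-yes (all? λ u → all? λ w → lineAdj u w Bool.≟ lineAdj w u)
  ; adj-irrefl = from-yes (all? λ u → lineAdj u u Bool.≟ false)
  }

-- Two meeting lines span a plane that contains exactly one further line. This excludes both `K4-e`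
-- and a clique of order four.
triangle-unique : ∀ u w → lineAdj u w ≡ true → ∀ x → lineAdj u x ≡ true → lineAdj w x ≡ true →
  ∀ y → lineAdj u y ≡ true → lineAdj w y ≡ true → x ≡ y
triangle-unique = from-yes (all? λ u → all? λ w → (lineAdj u w Bool.≟ true) →-dec
  all? λ x → (lineAdj u x Bool.≟ true) →-dec ((lineAdj w x Bool.≟ true) →-dec
  all? λ y → (lineAdj u y Bool.≟ true) →-dec ((lineAdj w y Bool.≟ true) →-dec (x ≟ y))))

-- Hypotheses alternate with quantifiers so that the check drops a partial configuration at its
-- first wrong adjacency.
no-P2+P4 : ∀ u w → lineAdj u w ≡ true →
  ∀ p → lineAdj u p ≡ false → lineAdj w p ≡ false →
  ∀ q → lineAdj p q ≡ true → lineAdj u q ≡ false → lineAdj w q ≡ false →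
  ∀ r → lineAdj q r ≡ true → lineAdj p r ≡ false → lineAdj u r ≡ false → lineAdj w r ≡ false →
  ∀ s → lineAdj r s ≡ true → lineAdj q s ≡ false → lineAdj p s ≡ false → lineAdj u s ≡ false → lineAdj w s ≡ true
no-P2+P4 = from-yes (
  all? λ u → all? λ w → adj? u w true →-dec
  (all? λ p → adj? u p false →-dec (adj? w p false →-dec
  (all? λ q → adj? p q true →-dec (adj? u q false →-dec (adj? w q false →-dec
  (all? λ r → adj? q r true →-dec (adj? p r false →-dec (adj? u r false →-dec (adj? w r false →-dec
  (all? λ s → adj? r s true →-dec (adj? q s false →-dec (adj? p s false →-dec (adj? u s false →-dec
  adj? w s true))))))))))))))
  where
  adj? : ∀ u w t → Dec (lineAdj u w ≡ t)
  adj? u w t = lineAdj u w Bool.≟ t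

Lines-P2+P4-free : Free Lines P2+P4
Lines-P2+P4-free (f , _ , f-adj) = case trans (sym far) near of λ ()
  where
  far : lineAdj (f (# 1)) (f (# 5)) ≡ false
  far = f-adj (# 1) (# 5)
  near : lineAdj (f (# 1)) (f (# 5)) ≡ true
  near = no-P2+P4 (f (# 0)) (f (# 1)) (f-adj (# 0) (# 1))
    (f (# 2)) (f-adj (# 0) (# 2)) (f-adj (# 1) (# 2))
    (f (# 3)) (f-adj (# 2) (# 3)) (f-adj (# 0) (# 3)) (f-adj (# 1) (# 3))
    (f (# 4)) (f-adj (# 3) (# 4)) (f-adj (# 2) (# 4)) (f-adj (# 0) (# 4)) (f-adj (# 1) (# 4))
    (f (# 5)) (f-adj (# 4) (# 5)) (f-adj (# 3) (# 5)) (f-adj (# 2) (# 5)) (f-adj (# 0) (# 5))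

Lines-K4-e-free : Free Lines K4-e
Lines-K4-e-free (f , f-inj , f-adj) = case f-inj 2≡3 of λ ()
  where
  2≡3 : f (# 2) ≡ f (# 3)
  2≡3 = triangle-unique (f (# 0)) (f (# 1)) (f-adj (# 0) (# 1))
    (f (# 2)) (f-adj (# 0) (# 2)) (f-adj (# 1) (# 2)) (f (# 3)) (f-adj (# 0) (# 3)) (f-adj (# 1) (# 3))

Lines-cliqueNumber : CliqueNumber Lines 3
Lines-cliqueNumber = Adjacency.hasClique Lines tritangent tritangent-adj , no-K4
  where
  tritangent : Fin 3 → Fin 27
  -- The coplanar lines `a 1`, `b 2` and `c 1 2`.
  tritangent = Vec.lookup (# 0 ∷ # 7 ∷ # 12 ∷ [])
  tritangent-adj : ∀ u w → u ≢ w → lineAdj (tritangent u) (tritangent w) ≡ true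
  tritangent-adj = from-yes (all? λ u → all? λ w →
    ¬? (u ≟ w) →-dec (lineAdj (tritangent u) (tritangent w) Bool.≟ true))
  no-K4 : ¬ HasClique Lines 4
  no-K4 (f , f-inj , f-adj) = case f-inj 2≡3 of λ ()
    where
    2≡3 : f (# 2) ≡ f (# 3)
    2≡3 = triangle-unique (f (# 0)) (f (# 1)) (f-adj (# 0) (# 1) λ ())
      (f (# 2)) (f-adj (# 0) (# 2) λ ()) (f-adj (# 1) (# 2) λ ())
      (f (# 3)) (f-adj (# 0) (# 3) λ ()) (f-adj (# 1) (# 3) λ ())

Lines-not-5-colourable : ¬ Colourable Lines 5
Lines-not-5-colourable (col , proper) =
  -- The search runs inside `refl`, with no class open and five available. Each level places one
  -- line, so the depth bound 28 is never exhausted by 27 lines.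
  refute-sound col proper 28 candidates refl (consistent (allFin 27)) [] ℕ.≤-refl
  where
  open Refutation lineAdj
  start : List (Fin 27) → List Candidate
  start = map (_, [])
  candidates : List Candidate
  candidates = start (allFin 27)
  consistent : ∀ us → All (Consistent col proper []) (start us)
  consistent [] = []
  consistent (_ ∷ us) = [] ∷ consistent us

Lines-chromaticNumber : ChromaticNumber Lines 6
Lines-chromaticNumber = (Vec.lookup colours , proper) , λ d d<6 (col , p) →
  Lines-not-5-colourable ((λ u → inject≤ (col u) (ℕ.≤-pred d<6)) ,
    λ u w u~w → p u w u~w ∘ inject≤-injective _ _ _ _)
  where
  -- The classes are the two halves of the double-six, then the c_ij grouped by smallest index 1, 2
  -- or 3, and finally those with both indices among 4, 5 and 6.
  colours : Vec (Fin 6) 27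
  colours =
    # 0 ∷ # 0 ∷ # 0 ∷ # 0 ∷ # 0 ∷ # 0 ∷
    # 1 ∷ # 1 ∷ # 1 ∷ # 1 ∷ # 1 ∷ # 1 ∷
    # 2 ∷ # 2 ∷ # 2 ∷ # 2 ∷ # 2 ∷
    # 3 ∷ # 3 ∷ # 3 ∷ # 3 ∷
    # 4 ∷ # 4 ∷ # 4 ∷ # 5 ∷ # 5 ∷ # 5 ∷ []
  proper : ∀ u w → lineAdj u w ≡ true → Vec.lookup colours u ≢ Vec.lookup colours w
  proper = from-yes (all? λ u → all? λ w → (lineAdj u w Bool.≟ true) →-dec
    ¬? (Vec.lookup colours u ≟ Vec.lookup colours w))

-- Complete graphs

Complete : ℕ → Graph
Complete k = record
  { n = k
  ; adj = λ u w → not (does (u ≟ w))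
  ; adj-sym = λ u w → cong not (≟-sym u w)
  ; adj-irrefl = λ u → cong not (dec-true (u ≟ u) refl)
  }
  where
  ≟-sym : ∀ {k} (u w : Fin k) → does (u ≟ w) ≡ does (w ≟ u)
  ≟-sym u w with u ≟ w
  ... | yes u≡w = sym (dec-true (w ≟ u) (sym u≡w))
  ... | no u≢w = sym (dec-false (w ≟ u) (u≢w ∘ sym))

Complete-adj : ∀ {k} {u w : Fin k} → u ≢ w → adj (Complete k) u w ≡ true
Complete-adj {u = u} {w} u≢w = cong not (dec-false (u ≟ w) u≢w)

Complete-free : ∀ k H (x y : Fin (n H)) → x ≢ y → adj H x y ≡ false → Free (Complete k) H
Complete-free k H x y x≢y x≁y (f , f-inj , f-adj) =
  case trans (sym (Complete-adj (x≢y ∘ f-inj))) (trans (f-adj x y) x≁y) of λ ()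

Complete-cliqueNumber : ∀ k → CliqueNumber (Complete k) k
Complete-cliqueNumber k =
  (id , id , λ u w → Complete-adj) , λ (f , f-inj , _) → ℕ.1+n≰n (injective⇒≤ f-inj)

Complete-chromaticNumber : ∀ k → ChromaticNumber (Complete k) k
Complete-chromaticNumber k = (id , proper) , λ d d<k (col , p) →
  ℕ.<⇒≱ d<k (injective⇒≤ {f = col} λ {u} {w} e →
    decidable-stable (u ≟ w) λ u≢w → p u w (Complete-adj u≢w) e)
  where
  proper : ∀ u w → adj (Complete k) u w ≡ true → u ≢ w
  proper u .u u~u refl = case trans (sym u~u) (adj-irrefl (Complete k) u) of λ ()

6⊔k-tight : (k : ℕ) → 3 ≤ k → k ≢ 4 → k ≢ 5 →
  Σ Graph λ G → Free G P2+P4 × Free G K4-e × CliqueNumber G k × ChromaticNumber G (6 ⊔ k)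
6⊔k-tight 1 (s≤s ()) _ _
6⊔k-tight 2 (s≤s (s≤s ())) _ _
6⊔k-tight 3 _ _ _ = Lines , Lines-P2+P4-free , Lines-K4-e-free , Lines-cliqueNumber , Lines-chromaticNumber
6⊔k-tight 4 _ k≢4 _ = contradiction refl k≢4
6⊔k-tight 5 _ _ k≢5 = contradiction refl k≢5
6⊔k-tight k@(suc (suc (suc (suc (suc (suc _)))))) _ _ _ =
  Complete k , Complete-free k P2+P4 (# 0) (# 2) (λ ()) refl , Complete-free k K4-e (# 2) (# 3) (λ ()) refl ,
  Complete-cliqueNumber k , Complete-chromaticNumber k

theorem1p1 : ((G : Graph) (ω : ℕ) → Free G P2+P4 → Free G K4-e → CliqueNumber G ω → 3 ≤ ω →
    Colourable G (6 ⊔ ω))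
    × ((k : ℕ) → 3 ≤ k → k ≢ 4 → k ≢ 5 →
    Σ Graph λ G → Free G P2+P4 × Free G K4-e × CliqueNumber G k × ChromaticNumber G (6 ⊔ k))
theorem1p1 = 6⊔ω-colourable , 6⊔k-tight
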